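{- Let $d\ge 1$, let $\mathbf{n}=(n_1,\ldots,n_d)$ be a $d$-tuple of positive integers, and let $s$ be a positive integer. Let $\Sigma^1_{\mathbf{n},s}$ denote the sum (componentwise) of all tensors in $\mathcal{T}^1_{\mathbf{n},s}$. Then for each $\mathbf{x}\in \Pi_{\mathbf{n}}$, \[ \Sigma^{1}_{\mathbf{n},s}[\mathbf{x}] = \sum_{k=0}^{\min\{\omega(\mathbf{n},\mathbf{x}), \: s-1\}} \binom{|\mathbf{n}| - d + s - k}{s-k-1} \cdot [t^k] \, A_{\mathbf{x}-\mathbf 1}(t) A_{\mathbf{n} - \mathbf{x}}(t), \] where $\omega(\mathbf{n},\mathbf{x}) = |\mathbf{n}| - \max(\mathbf{x}) - \max(\mathbf{n}-\mathbf{x}) - d + 1$ and $[t^k]$ denotes the coefficient of $t^k$.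
   Context: $\Pi_{\mathbf{n}}=[n_1]\times\cdots\times[n_d]$ (where $[m]=\{1,\ldots,m\}$) with the product order: $\mathbf a\le\mathbf b$ iff $a_i\le b_i$ for all $i$. For a tuple $\mathbf{y}$, $|\mathbf y|=\sum_i y_i$, $\max(\mathbf y)=\max_i y_i$, $\mathbf 1=(1,\ldots,1)$, and subtraction is componentwise. A tensor $T\in\mathbb{R}^{n_1}\otimes\cdots\otimes\mathbb{R}^{n_d}$ is identified with its array of components $T[\mathbf{x}]$, $\mathbf{x}\in\Pi_{\mathbf{n}}$; $T$ has width one if its support $\{\mathbf{x}:T[\mathbf{x}]\ne0\}$ is a chain of $\Pi_{\mathbf{n}}$. $\mathcal{T}^1_{\mathbf{n},s}$ is the set of width-one tensors with nonnegative integer components summing to $s$. For a tuple $\mathbf p=(p_1,\ldots,p_d)$ of nonnegative integers, $\mathfrak S_{\mathbf p}$ is the set of words of length $|\mathbf p|$ in which each letter $i\in[d]$ appears exactly $p_i$ times; a descent of a word $\pi$ is an index $i$ with $\pi_i>\pi_{i+1}$, and the multiset Eulerian polynomial is $A_{\mathbf p}(t)=\sum_{\pi\in\mathfrak S_{\mathbf p}}t^{\mathrm{des}(\pi)}$, where $\mathrm{des}(\pi)$ is the number of descents of $\pi$. -}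

module Defs where

open import Data.Nat using (ℕ; zero; suc; _+_; _*_; _∸_; _⊔_; _⊓_; _≡ᵇ_; _≤ᵇ_; _<ᵇ_)
open import Data.Nat.Combinatorics using (_C_)
open import Data.Bool using (Bool; true; false; _∧_; _∨_; not)
open import Data.List using (List; []; _∷_; map; concatMap; upTo; length; filterᵇ; zipWith)
open import Data.Nat.ListAction using (sum)
open import Data.Bool.ListAction using (all; and)
open import Data.Product using (_×_; _,_; proj₁; proj₂)
open import Data.Vec as V using (Vec)

range1 : ℕ → List ℕ
range1 m = map suc (upTo m)

range0 : ℕ → List ℕ
range0 m = upTo (suc m)

∣_∣ᵥ : ∀ {d} → Vec ℕ d → ℕ
∣ y ∣ᵥ = V.sum y

maxᵥ : ∀ {d} → Vec ℕ d → ℕ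
maxᵥ y = V.foldr _ _⊔_ 0 y

_-ᵥ_ : ∀ {d} → Vec ℕ d → Vec ℕ d → Vec ℕ d
a -ᵥ b = V.zipWith _∸_ a b

𝟏 : ∀ d → Vec ℕ d
𝟏 d = V.replicate d 1

points : ∀ {d} → Vec ℕ d → List (Vec ℕ d)
points V.[] = V.[] ∷ []
points (m V.∷ ns) = concatMap (λ a → map (a V.∷_) (points ns)) (range1 m)

eqᵥ : ∀ {d} → Vec ℕ d → Vec ℕ d → Bool
eqᵥ a b = V.foldr _ _∧_ true (V.zipWith _≡ᵇ_ a b)

leqᵥ : ∀ {d} → Vec ℕ d → Vec ℕ d → Bool
leqᵥ a b = V.foldr _ _∧_ true (V.zipWith _≤ᵇ_ a b)

-- Tensors with nonnegative integer components, represented by their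
-- graph: a list of pairs (x , T[x]) with x ranging over points n
-- (in that order, each point exactly once).

Tensor : ℕ → Set
Tensor d = List (Vec ℕ d × ℕ)

component : ∀ {d} → Tensor d → Vec ℕ d → ℕ
component T x = sum (map (λ e → if eqᵥ (proj₁ e) x then proj₂ e else 0) T)
  where
  if_then_else_ : Bool → ℕ → ℕ → ℕ
  if true then a else b = a
  if false then a else b = b

total : ∀ {d} → Tensor d → ℕ
total T = sum (map proj₂ T)

widthOne : ∀ {d} → Tensor d → Bool
widthOne T =
  all (λ e → all (λ f →
        (proj₂ e ≡ᵇ 0) ∨ (proj₂ f ≡ᵇ 0) ∨
        leqᵥ (proj₁ e) (proj₁ f) ∨ leqᵥ (proj₁ f) (proj₁ e)) T) T

assignments : ∀ {d} → List (Vec ℕ d) → ℕ → List (Tensor d)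
assignments [] s = [] ∷ []
assignments (p ∷ ps) s =
  concatMap (λ v → map ((p , v) ∷_) (assignments ps s)) (range0 s)

-- T^1_{n,s}: width-one tensors with nonnegative integer components
-- summing to s (such components are automatically ≤ s)
widthOneTensors : ∀ {d} → Vec ℕ d → ℕ → List (Tensor d)
widthOneTensors n s =
  filterᵇ (λ T → widthOne T ∧ (total T ≡ᵇ s)) (assignments (points n) s)

Σ¹ : ∀ {d} → Vec ℕ d → ℕ → Vec ℕ d → ℕ
Σ¹ n s x = sum (map (λ T → component T x) (widthOneTensors n s))

allWords : ℕ → ℕ → List (List ℕ)
allWords d zero = [] ∷ []
allWords d (suc m) = concatMap (λ a → map (a ∷_) (allWords d m)) (range1 d)

count : ℕ → List ℕ → ℕ
count i w = length (filterᵇ (λ a → a ≡ᵇ i) w)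

multisetWords : ∀ {d} → Vec ℕ d → List (List ℕ)
multisetWords {d} p =
  filterᵇ (λ w → and (zipWith (λ i pᵢ → count i w ≡ᵇ pᵢ) (range1 d) (V.toList p)))
          (allWords d ∣ p ∣ᵥ)

des : List ℕ → ℕ
des [] = 0
des (a ∷ []) = 0
des (a ∷ b ∷ w) = (if' (b <ᵇ a)) + des (b ∷ w)
  where
  if' : Bool → ℕ
  if' true = 1
  if' false = 0

eulerCoeff : ∀ {d} → Vec ℕ d → ℕ → ℕ
eulerCoeff p k = length (filterᵇ (λ π → des π ≡ᵇ k) (multisetWords p))

coeffMul : (ℕ → ℕ) → (ℕ → ℕ) → ℕ → ℕ
coeffMul f g k = sum (map (λ j → f j * g (k ∸ j)) (range0 k))

-- ω(n,x) = |n| - max(x) - max(n-x) - d + 1  (nonnegative for x ∈ Π_n)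
ω : ∀ {d} → Vec ℕ d → Vec ℕ d → ℕ
ω {d} n x = (∣ n ∣ᵥ + 1) ∸ (maxᵥ x + maxᵥ (n -ᵥ x) + d)

rhs : ∀ {d} → Vec ℕ d → ℕ → Vec ℕ d → ℕ
rhs {d} n s x =
  sum (map (λ k → ((∣ n ∣ᵥ ∸ d + s ∸ k) C (s ∸ k ∸ 1)) *
                  coeffMul (eulerCoeff (x -ᵥ 𝟏 d)) (eulerCoeff (n -ᵥ x)) k)
           (range0 (ω n x ⊓ (s ∸ 1))))

{-# OPTIONS --safe #-}
module Submission where

-- A width-one tensor with total s is a multichain of length s, and its
-- component at x is the multiplicity of x in it. Cutting at an occurrence
-- of x gives
--   Σ_s Σ¹[x] t^s = t · Z_{x-1}(t) · Z_{n-x}(t),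
-- where Z_p(t) = Σ_m Π_i C(p_i + m, m) t^m enumerates the multichains of a
-- product of chains. By MacMahon's identity Z_p(t) = A_p(t) / (1 - t)^(|p|+1),
-- so the right-hand side is t A_{x-1}(t) A_{n-x}(t) / (1 - t)^(|n|-d+2); the
-- truncation of the sum at ω is harmless because deg A_p ≤ |p| - max p.

open import Defs
open import Data.Bool using (Bool; true; false; _∧_; _∨_; not; if_then_else_)
open import Data.Bool.ListAction using (all; and)
open import Data.Bool.Properties using (∧-assoc; ∧-comm; ∨-comm; ∧-identityʳ; ∨-identityʳ; ∧-zeroʳ; ∨-zeroʳ; ∧-idem; T-≡)
open import Data.Empty using (⊥-elim)
open import Data.Fin using (zero; suc)
open import Data.List using (List; []; _∷_; map; concatMap; upTo; applyUpTo; zipWith; length; filterᵇ; _++_)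
open import Data.List.Properties using (map-upTo; map-∘)
open import Data.List.Relation.Unary.All as All using (All; []; _∷_)
import Data.List.Relation.Unary.All.Properties as All
open import Data.List.Relation.Unary.AllPairs using (AllPairs; []; _∷_)
import Data.List.Relation.Unary.AllPairs.Properties as AllPairs
open import Data.Nat
open import Data.Nat.Combinatorics using (_C_; nCn≡1; nCk+nC[k+1]≡[n+1]C[k+1])
open import Data.Nat.ListAction using (sum)
open import Data.Nat.Properties
open import Data.Nat.Tactic.RingSolver using (solve-∀)
open import Data.Product using (_×_; _,_; proj₁; proj₂)
open import Data.Sum using (_⊎_; inj₁; inj₂)
open import Data.Vec as V using (Vec; lookup)
open import Function using (_∘_; id; Equivalence)
open import Relation.Binary.Definitions using (tri<; tri≈; tri>)
open import Relation.Binary.PropositionalEquality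
open import Relation.Nullary using (yes; no)
open import Algebra.Properties.CommutativeSemigroup +-commutativeSemigroup using (interchange)

open ≡-Reasoning

-- Finite sums and power series

-- A component v at x enters the sum with weight v, and the series of v t^v is t/(1 - t)^2: one
-- factor 1/(1 - t) lets x belong to the part below the cut, the other to the part above. Points on
-- opposite sides of x are comparable with each other, so the chain conditions on the two parts are
-- independent and the enumerators multiply.
--
-- For MacMahon's identity, t^des(w)/(1 - t)^(L+1) enumerates the ways to put the L letters of w on
-- weakly increasing levels that rise strictly at each descent. Such a levelled word is a multiset
-- of pairs (level, letter), listed lexicographically. Choosing the multiset letter by letter gives
-- the product of binomials. Reading the list from the left, an induction has to remember the last
-- letter read, so the statement is generalised to sequences that start at or after a given letter
-- of the first level.
--
-- All counts are natural numbers: dividing a series by 1 - t becomes partial summation, and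
-- differences are replaced by sums with extra terms on both sides.

⟦_⟧ : Bool → ℕ
⟦ true ⟧ = 1
⟦ false ⟧ = 0

⟦⟧-∧ : ∀ a b → ⟦ a ∧ b ⟧ ≡ ⟦ a ⟧ * ⟦ b ⟧
⟦⟧-∧ true b = sym (*-identityˡ _)
⟦⟧-∧ false b = refl

∑ : {A : Set} → List A → (A → ℕ) → ℕ
∑ xs f = sum (map f xs)

module _ {A : Set} where

  ∑-cong : ∀ (xs : List A) {f g} → (∀ x → f x ≡ g x) → ∑ xs f ≡ ∑ xs g
  ∑-cong [] f≗g = refl
  ∑-cong (x ∷ xs) f≗g = cong₂ _+_ (f≗g x) (∑-cong xs f≗g)

  ∑-congᴬ : ∀ {xs : List A} {f g} → All (λ x → f x ≡ g x) xs → ∑ xs f ≡ ∑ xs g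
  ∑-congᴬ [] = refl
  ∑-congᴬ (e ∷ es) = cong₂ _+_ e (∑-congᴬ es)

  ∑-++ : ∀ (xs ys : List A) f → ∑ (xs ++ ys) f ≡ ∑ xs f + ∑ ys f
  ∑-++ [] ys f = refl
  ∑-++ (x ∷ xs) ys f = trans (cong (f x +_) (∑-++ xs ys f)) (sym (+-assoc (f x) _ _))

  ∑-zero : ∀ (xs : List A) → ∑ xs (λ _ → 0) ≡ 0
  ∑-zero [] = refl
  ∑-zero (x ∷ xs) = ∑-zero xs

  ∑-+ : ∀ (xs : List A) f g → ∑ xs (λ x → f x + g x) ≡ ∑ xs f + ∑ xs g
  ∑-+ [] f g = refl
  ∑-+ (x ∷ xs) f g = trans (cong (f x + g x +_) (∑-+ xs f g)) (interchange (f x) (g x) _ _)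

  ∑-*ˡ : ∀ (xs : List A) c f → ∑ xs (λ x → c * f x) ≡ c * ∑ xs f
  ∑-*ˡ [] c f = sym (*-zeroʳ c)
  ∑-*ˡ (x ∷ xs) c f = trans (cong (c * f x +_) (∑-*ˡ xs c f)) (sym (*-distribˡ-+ c (f x) _))

  ∑-*ʳ : ∀ (xs : List A) c f → ∑ xs (λ x → f x * c) ≡ ∑ xs f * c
  ∑-*ʳ [] c f = refl
  ∑-*ʳ (x ∷ xs) c f = trans (cong (f x * c +_) (∑-*ʳ xs c f)) (sym (*-distribʳ-+ c (f x) _))

  ∑-filterᵇ : ∀ (P : A → Bool) xs f → ∑ (filterᵇ P xs) f ≡ ∑ xs (λ x → ⟦ P x ⟧ * f x)
  ∑-filterᵇ P [] f = refl
  ∑-filterᵇ P (x ∷ xs) f with P x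
  ... | true = cong₂ _+_ (sym (*-identityˡ (f x))) (∑-filterᵇ P xs f)
  ... | false = ∑-filterᵇ P xs f

  length-filterᵇ : ∀ (P : A → Bool) xs → length (filterᵇ P xs) ≡ ∑ xs (λ x → ⟦ P x ⟧)
  length-filterᵇ P [] = refl
  length-filterᵇ P (x ∷ xs) with P x
  ... | true = cong suc (length-filterᵇ P xs)
  ... | false = length-filterᵇ P xs

  ∑-map : ∀ {B : Set} (h : B → A) xs f → ∑ (map h xs) f ≡ ∑ xs (f ∘ h)
  ∑-map h xs f = cong sum (sym (map-∘ xs))

  ∑-concatMap : ∀ {B : Set} (h : B → List A) xs f → ∑ (concatMap h xs) f ≡ ∑ xs (λ x → ∑ (h x) f)
  ∑-concatMap h [] f = refl
  ∑-concatMap h (x ∷ xs) f = trans (∑-++ (h x) _ f) (cong (∑ (h x) f +_) (∑-concatMap h xs f))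

∑-upTo-suc : ∀ n f → ∑ (upTo (suc n)) f ≡ f 0 + ∑ (upTo n) (f ∘ suc)
∑-upTo-suc n f = begin
  ∑ (upTo (suc n)) f                   ≡⟨ cong sum (map-upTo f (suc n)) ⟩
  f 0 + sum (applyUpTo (f ∘ suc) n)    ≡⟨ cong (λ l → f 0 + sum l) (map-upTo (f ∘ suc) n) ⟨
  f 0 + ∑ (upTo n) (f ∘ suc)           ∎

∑-upTo-last : ∀ n f → ∑ (upTo (suc n)) f ≡ ∑ (upTo n) f + f n
∑-upTo-last zero f = +-identityʳ (f 0)
∑-upTo-last (suc n) f = begin
  ∑ (upTo (2 + n)) f                               ≡⟨ ∑-upTo-suc (suc n) f ⟩
  f 0 + ∑ (upTo (suc n)) (f ∘ suc)                 ≡⟨ cong (f 0 +_) (∑-upTo-last n (f ∘ suc)) ⟩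
  f 0 + (∑ (upTo n) (f ∘ suc) + f (suc n))         ≡⟨ +-assoc (f 0) _ _ ⟨
  f 0 + ∑ (upTo n) (f ∘ suc) + f (suc n)           ≡⟨ cong (_+ f (suc n)) (∑-upTo-suc n f) ⟨
  ∑ (upTo (suc n)) f + f (suc n)                   ∎

∑-upTo-cong : ∀ n {f g} → (∀ i → i < n → f i ≡ g i) → ∑ (upTo n) f ≡ ∑ (upTo n) g
∑-upTo-cong zero eq = refl
∑-upTo-cong (suc n) {f} {g} eq = begin
  ∑ (upTo (suc n)) f                   ≡⟨ ∑-upTo-suc n f ⟩
  f 0 + ∑ (upTo n) (f ∘ suc)           ≡⟨ cong₂ _+_ (eq 0 z<s) (∑-upTo-cong n (λ i i<n → eq (suc i) (s<s i<n))) ⟩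
  g 0 + ∑ (upTo n) (g ∘ suc)           ≡⟨ ∑-upTo-suc n g ⟨
  ∑ (upTo (suc n)) g                   ∎

∑-upTo-extend : ∀ m n f → (∀ i → m ≤ i → f i ≡ 0) → ∑ (upTo (m + n)) f ≡ ∑ (upTo m) f
∑-upTo-extend m zero f f0 = cong (λ k → ∑ (upTo k) f) (+-identityʳ m)
∑-upTo-extend m (suc n) f f0 = begin
  ∑ (upTo (m + suc n)) f         ≡⟨ cong (λ k → ∑ (upTo k) f) (+-suc m n) ⟩
  ∑ (upTo (suc (m + n))) f       ≡⟨ ∑-upTo-last (m + n) f ⟩
  ∑ (upTo (m + n)) f + f (m + n) ≡⟨ cong₂ _+_ (∑-upTo-extend m n f f0) (f0 (m + n) (m≤m+n m n)) ⟩
  ∑ (upTo m) f + 0               ≡⟨ +-identityʳ _ ⟩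
  ∑ (upTo m) f                   ∎

-- Sequences as formal power series: conv is the product, δ is 1, one is
-- 1/(1 − t) and sg is multiplication by t/(1 − t).

conv : (ℕ → ℕ) → (ℕ → ℕ) → ℕ → ℕ
conv f g zero = f 0 * g 0
conv f g (suc n) = f 0 * g (suc n) + conv (f ∘ suc) g n

δ : ℕ → ℕ
δ zero = 1
δ (suc _) = 0

one : ℕ → ℕ
one _ = 1

sg : (ℕ → ℕ) → ℕ → ℕ
sg f zero = 0
sg f (suc n) = f n + sg f n

conv-cong : ∀ {f f′ g g′} → f ≗ f′ → g ≗ g′ → conv f g ≗ conv f′ g′
conv-cong p q zero = cong₂ _*_ (p 0) (q 0)
conv-cong p q (suc n) = cong₂ _+_ (cong₂ _*_ (p 0) (q (suc n))) (conv-cong (p ∘ suc) q n)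

conv-+ˡ : ∀ f g h n → conv (λ i → f i + g i) h n ≡ conv f h n + conv g h n
conv-+ˡ f g h zero = *-distribʳ-+ (h 0) (f 0) (g 0)
conv-+ˡ f g h (suc n) = trans
  (cong₂ _+_ (*-distribʳ-+ (h (suc n)) (f 0) (g 0)) (conv-+ˡ (f ∘ suc) (g ∘ suc) h n))
  (interchange (f 0 * h (suc n)) (g 0 * h (suc n)) _ _)

conv-*ˡ : ∀ c f h n → conv (λ i → c * f i) h n ≡ c * conv f h n
conv-*ˡ c f h zero = *-assoc c (f 0) (h 0)
conv-*ˡ c f h (suc n) = trans
  (cong₂ _+_ (*-assoc c (f 0) (h (suc n))) (conv-*ˡ c (f ∘ suc) h n))
  (sym (*-distribˡ-+ c (f 0 * h (suc n)) _))

conv-zeroˡ : ∀ h n → conv (λ _ → 0) h n ≡ 0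
conv-zeroˡ h zero = refl
conv-zeroˡ h (suc n) = conv-zeroˡ h n

-- `conv` consumes its left factor from the front. Consuming the right factor instead makes
-- commutativity an induction.
conv-last : ∀ f g n → conv f g (suc n) ≡ g 0 * f (suc n) + conv f (g ∘ suc) n
conv-last f g zero = solve4 (f 0) (f 1) (g 0) (g 1)
  where
  solve4 : ∀ a b c d → a * d + b * c ≡ c * b + a * d
  solve4 = solve-∀
conv-last f g (suc n) = begin
  f 0 * g (2 + n) + conv (f ∘ suc) g (suc n)
    ≡⟨ cong (f 0 * g (2 + n) +_) (conv-last (f ∘ suc) g n) ⟩
  f 0 * g (2 + n) + (g 0 * f (2 + n) + conv (f ∘ suc) (g ∘ suc) n)
    ≡⟨ swap (f 0 * g (2 + n)) (g 0 * f (2 + n)) _ ⟩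
  g 0 * f (2 + n) + (f 0 * g (2 + n) + conv (f ∘ suc) (g ∘ suc) n) ∎
  where
  swap : ∀ a b c → a + (b + c) ≡ b + (a + c)
  swap = solve-∀

conv-comm : ∀ f g n → conv f g n ≡ conv g f n
conv-comm f g zero = *-comm (f 0) (g 0)
conv-comm f g (suc n) = trans (cong (f 0 * g (suc n) +_) (conv-comm (f ∘ suc) g n))
                              (sym (conv-last g f n))

conv-assoc : ∀ f g h n → conv (conv f g) h n ≡ conv f (conv g h) n
conv-assoc f g h zero = *-assoc (f 0) (g 0) (h 0)
conv-assoc f g h (suc n) = begin
  f 0 * g 0 * h (suc n) + conv (λ i → f 0 * g (suc i) + conv (f ∘ suc) g i) h n
    ≡⟨ cong (f 0 * g 0 * h (suc n) +_) (conv-+ˡ (λ i → f 0 * g (suc i)) (conv (f ∘ suc) g) h n) ⟩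
  f 0 * g 0 * h (suc n) + (conv (λ i → f 0 * g (suc i)) h n + conv (conv (f ∘ suc) g) h n)
    ≡⟨ cong₂ (λ u v → f 0 * g 0 * h (suc n) + (u + v))
         (conv-*ˡ (f 0) (g ∘ suc) h n) (conv-assoc (f ∘ suc) g h n) ⟩
  f 0 * g 0 * h (suc n) + (f 0 * conv (g ∘ suc) h n + conv (f ∘ suc) (conv g h) n)
    ≡⟨ regroup (f 0) (g 0) (h (suc n)) _ _ ⟩
  f 0 * (g 0 * h (suc n) + conv (g ∘ suc) h n) + conv (f ∘ suc) (conv g h) n ∎
  where
  regroup : ∀ a b c x y → a * b * c + (a * x + y) ≡ a * (b * c + x) + y
  regroup = solve-∀

conv-interchange : ∀ f g h k → conv (conv f g) (conv h k) ≗ conv (conv f h) (conv g k)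
conv-interchange f g h k n = begin
  conv (conv f g) (conv h k) n     ≡⟨ conv-assoc f g _ n ⟩
  conv f (conv g (conv h k)) n     ≡⟨ conv-cong {f} (λ _ → refl) (λ i → sym (conv-assoc g h k i)) n ⟩
  conv f (conv (conv g h) k) n     ≡⟨ conv-cong {f} (λ _ → refl) (conv-cong (conv-comm g h) (λ _ → refl)) n ⟩
  conv f (conv (conv h g) k) n     ≡⟨ conv-cong {f} (λ _ → refl) (conv-assoc h g k) n ⟩
  conv f (conv h (conv g k)) n     ≡⟨ conv-assoc f h _ n ⟨
  conv (conv f h) (conv g k) n     ∎

conv-δˡ : ∀ g → conv δ g ≗ g
conv-δˡ g zero = *-identityˡ (g 0)
conv-δˡ g (suc n) = trans (cong₂ _+_ (*-identityˡ (g (suc n))) (conv-zeroˡ g n)) (+-identityʳ _)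

conv-one : ∀ g n → conv one g n ≡ g n + sg g n
conv-one g zero = refl
conv-one g (suc n) = cong₂ _+_ (*-identityˡ _) (conv-one g n)

sg-cong : ∀ {f g} → f ≗ g → sg f ≗ sg g
sg-cong p zero = refl
sg-cong p (suc n) = cong₂ _+_ (p n) (sg-cong p n)

sg-cong-< : ∀ {f g} n → (∀ i → i < n → f i ≡ g i) → sg f n ≡ sg g n
sg-cong-< zero e = refl
sg-cong-< (suc n) e = cong₂ _+_ (e n ≤-refl) (sg-cong-< n (λ i i<n → e i (m≤n⇒m≤1+n i<n)))

sg-+ : ∀ f g n → sg (λ i → f i + g i) n ≡ sg f n + sg g n
sg-+ f g zero = refl
sg-+ f g (suc n) = trans (cong (f n + g n +_) (sg-+ f g n)) (interchange (f n) (g n) _ _)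

sg-*ˡ : ∀ c f n → sg (λ i → c * f i) n ≡ c * sg f n
sg-*ˡ c f zero = sym (*-zeroʳ c)
sg-*ˡ c f (suc n) = trans (cong (c * f n +_) (sg-*ˡ c f n)) (sym (*-distribˡ-+ c (f n) _))

sg-zero : ∀ {f} → (∀ n → f n ≡ 0) → ∀ n → sg f n ≡ 0
sg-zero p zero = refl
sg-zero p (suc n) = cong₂ _+_ (p n) (sg-zero p n)

sg-suc : ∀ f n → sg f (suc n) ≡ conv one f n
sg-suc f n = sym (conv-one f n)

conv-sgˡ : ∀ f g n → conv (sg f) g n ≡ sg (conv f g) n
conv-sgˡ f g zero = refl
conv-sgˡ f g (suc n) = begin
  conv (sg f ∘ suc) g n         ≡⟨ conv-cong {sg f ∘ suc} (sg-suc f) (λ _ → refl) n ⟩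
  conv (conv one f) g n         ≡⟨ conv-assoc one f g n ⟩
  conv one (conv f g) n         ≡⟨ sg-suc (conv f g) n ⟨
  sg (conv f g) (suc n)         ∎

conv-sgʳ : ∀ f g n → conv f (sg g) n ≡ sg (conv f g) n
conv-sgʳ f g n = begin
  conv f (sg g) n   ≡⟨ conv-comm f (sg g) n ⟩
  conv (sg g) f n   ≡⟨ conv-sgˡ g f n ⟩
  sg (conv g f) n   ≡⟨ sg-cong (conv-comm g f) n ⟩
  sg (conv f g) n   ∎

conv-∑ : ∀ f g n → conv f g n ≡ ∑ (upTo (suc n)) (λ k → f k * g (n ∸ k))
conv-∑ f g zero = sym (+-identityʳ _)
conv-∑ f g (suc n) = trans (cong (f 0 * g (suc n) +_) (conv-∑ (f ∘ suc) g n))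
                           (sym (∑-upTo-suc (suc n) (λ k → f k * g (suc n ∸ k))))

conv-∑ˡ : ∀ {A : Set} (xs : List A) (F : A → ℕ → ℕ) g n →
          conv (λ k → ∑ xs (λ x → F x k)) g n ≡ ∑ xs (λ x → conv (F x) g n)
conv-∑ˡ [] F g n = conv-zeroˡ g n
conv-∑ˡ (x ∷ xs) F g n = trans (conv-+ˡ (F x) _ g n) (cong (conv (F x) g n +_) (conv-∑ˡ xs F g n))

-- H L m = (L + m) choose m, the coefficient of t^m in 1/(1 − t)^(L + 1).

H : ℕ → ℕ → ℕ
H zero m = 1
H (suc L) zero = 1
H (suc L) (suc m) = H (suc L) m + H L (suc m)

H-0 : ∀ L → H L 0 ≡ 1
H-0 zero = refl
H-0 (suc L) = refl

H-sym : ∀ L m → H L m ≡ H m L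
H-sym zero m = sym (H-0 m)
H-sym (suc L) zero = refl
H-sym (suc L) (suc m) = trans (+-comm (H (suc L) m) _) (cong₂ _+_ (H-sym L (suc m)) (H-sym (suc L) m))

H-C : ∀ L m → H L m ≡ (L + m) C m
H-C zero m = sym (nCn≡1 m)
H-C (suc L) zero = refl
H-C (suc L) (suc m) = begin
  H (suc L) m + H L (suc m)                        ≡⟨ cong₂ _+_ (H-C (suc L) m) (H-C L (suc m)) ⟩
  (suc L + m) C m + (L + suc m) C (suc m)          ≡⟨ cong (λ k → k C m + (L + suc m) C (suc m)) (sym (+-suc L m)) ⟩
  (L + suc m) C m + (L + suc m) C (suc m)          ≡⟨ nCk+nC[k+1]≡[n+1]C[k+1] (L + suc m) m ⟩
  (suc L + suc m) C (suc m)                        ∎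

H-suc : ∀ L → H (suc L) ≗ conv one (H L)
H-suc L zero = sym (trans (+-identityʳ _) (H-0 L))
H-suc L (suc m) = begin
  H (suc L) m + H L (suc m)       ≡⟨ +-comm _ (H L (suc m)) ⟩
  H L (suc m) + H (suc L) m       ≡⟨ cong₂ _+_ (sym (*-identityˡ _)) (H-suc L m) ⟩
  conv one (H L) (suc m)          ∎

-- The exponents K + 1 and L + 1 of 1/(1 - t) add up to (K + L + 1) + 1, hence the extra `suc`.
H-conv : ∀ K L → conv (H K) (H L) ≗ H (suc (K + L))
H-conv zero L n = sym (H-suc L n)
H-conv (suc K) L n = begin
  conv (H (suc K)) (H L) n          ≡⟨ conv-cong (H-suc K) (λ _ → refl) n ⟩
  conv (conv one (H K)) (H L) n     ≡⟨ conv-assoc one (H K) (H L) n ⟩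
  conv one (conv (H K) (H L)) n     ≡⟨ conv-cong {one} (λ _ → refl) (H-conv K L) n ⟩
  conv one (H (suc (K + L))) n      ≡⟨ H-suc (suc (K + L)) n ⟨
  H (suc (suc K + L)) n             ∎

-- Width-one tensors on a list of points

≤ᵇ-true : ∀ {m n} → m ≤ n → (m ≤ᵇ n) ≡ true
≤ᵇ-true = Equivalence.to T-≡ ∘ ≤⇒≤ᵇ

true-≤ᵇ : ∀ {m n} → (m ≤ᵇ n) ≡ true → m ≤ n
true-≤ᵇ {m} {n} = ≤ᵇ⇒≤ m n ∘ Equivalence.from T-≡

≤ᵇ-false : ∀ {m n} → n < m → (m ≤ᵇ n) ≡ false
≤ᵇ-false {m} {n} n<m with m ≤ᵇ n in eq
... | false = refl
... | true = ⊥-elim (<⇒≱ n<m (true-≤ᵇ eq))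

≡ᵇ-refl : ∀ n → (n ≡ᵇ n) ≡ true
≡ᵇ-refl n = Equivalence.to T-≡ (≡⇒≡ᵇ n n refl)

true-≡ᵇ : ∀ {m n} → (m ≡ᵇ n) ≡ true → m ≡ n
true-≡ᵇ {m} {n} = ≡ᵇ⇒≡ m n ∘ Equivalence.from T-≡

∧-trueˡ : ∀ {a b} → a ∧ b ≡ true → a ≡ true
∧-trueˡ {true} _ = refl

∧-trueʳ : ∀ {a b} → a ∧ b ≡ true → b ≡ true
∧-trueʳ {true} e = e

all-cong : ∀ {A : Set} {f g : A → Bool} xs → f ≗ g → all f xs ≡ all g xs
all-cong [] e = refl
all-cong (x ∷ xs) e = cong₂ _∧_ (e x) (all-cong xs e)

all-∧ : ∀ {A : Set} (f g : A → Bool) xs → all (λ x → f x ∧ g x) xs ≡ all f xs ∧ all g xs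
all-∧ f g [] = refl
all-∧ f g (x ∷ xs) rewrite all-∧ f g xs = lem (f x) (g x) (all f xs) (all g xs)
  where
  lem : ∀ a b c d → (a ∧ b) ∧ (c ∧ d) ≡ (a ∧ c) ∧ (b ∧ d)
  lem false b c d = refl
  lem true false false d = refl
  lem true false true d = refl
  lem true true c d = refl

all-true : ∀ {A : Set} (xs : List A) → all (λ _ → true) xs ≡ true
all-true [] = refl
all-true (x ∷ xs) = all-true xs

leq-refl : ∀ {d} (p : Vec ℕ d) → leqᵥ p p ≡ true
leq-refl V.[] = refl
leq-refl (a V.∷ p) = cong₂ _∧_ (≤ᵇ-true (≤-refl {a})) (leq-refl p)

leq-trans : ∀ {d} (p q r : Vec ℕ d) → leqᵥ p q ≡ true → leqᵥ q r ≡ true → leqᵥ p r ≡ true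
leq-trans V.[] V.[] V.[] _ _ = refl
leq-trans (a V.∷ p) (b V.∷ q) (c V.∷ r) e f = cong₂ _∧_
  (≤ᵇ-true (≤-trans (true-≤ᵇ {a} {b} (∧-trueˡ e)) (true-≤ᵇ {b} {c} (∧-trueˡ f))))
  (leq-trans p q r (∧-trueʳ {a ≤ᵇ b} e) (∧-trueʳ {b ≤ᵇ c} f))

leq-antisym : ∀ {d} (p q : Vec ℕ d) → leqᵥ p q ≡ true → leqᵥ q p ≡ true → p ≡ q
leq-antisym V.[] V.[] _ _ = refl
leq-antisym (a V.∷ p) (b V.∷ q) e f = cong₂ V._∷_
  (≤-antisym (true-≤ᵇ {a} (∧-trueˡ e)) (true-≤ᵇ {b} (∧-trueˡ f)))
  (leq-antisym p q (∧-trueʳ {a ≤ᵇ b} e) (∧-trueʳ {b ≤ᵇ a} f))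

eq-refl : ∀ {d} (p : Vec ℕ d) → eqᵥ p p ≡ true
eq-refl V.[] = refl
eq-refl (a V.∷ p) = cong₂ _∧_ (≡ᵇ-refl a) (eq-refl p)

true-eq : ∀ {d} (p q : Vec ℕ d) → eqᵥ p q ≡ true → p ≡ q
true-eq V.[] V.[] _ = refl
true-eq (a V.∷ p) (b V.∷ q) e = cong₂ V._∷_ (true-≡ᵇ {a} (∧-trueˡ e)) (true-eq p q (∧-trueʳ {a ≡ᵇ b} e))

comp : ∀ {d} → Vec ℕ d → Vec ℕ d → Bool
comp p q = leqᵥ p q ∨ leqᵥ q p

comp-sym : ∀ {d} (p q : Vec ℕ d) → comp p q ≡ comp q p
comp-sym p q = ∨-comm (leqᵥ p q) _

comp-refl : ∀ {d} (p : Vec ℕ d) → comp p p ≡ true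
comp-refl p = cong (_∨ leqᵥ p p) (leq-refl p)

module _ {d : ℕ} where

  -- Once `p` is in the support, later support points must be comparable with it. Recording this in
  -- the predicate lets the chain condition be checked one point at a time.
  _∩_ : (Vec ℕ d → Bool) → Vec ℕ d → Vec ℕ d → Bool
  (P ∩ p) q = P q ∧ comp p q

  -- The generating function, by total, of the width-one tensors on the
  -- list of points whose support lies in P.
  W : (Vec ℕ d → Bool) → List (Vec ℕ d) → ℕ → ℕ
  W P [] s = δ s
  W P (p ∷ ps) s = W P ps s + ⟦ P p ⟧ * sg (W (P ∩ p) ps) s

  W-congᴬ : ∀ {P Q} ps → All (λ q → P q ≡ Q q) ps → W P ps ≗ W Q ps
  W-congᴬ [] [] s = refl
  W-congᴬ (p ∷ ps) (e ∷ es) s = cong₂ _+_ (W-congᴬ ps es s)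
    (cong₂ (λ b k → ⟦ b ⟧ * k) e
      (sg-cong (W-congᴬ ps (All.map (λ {q} → cong (_∧ comp p q)) es)) s))

  W-cong : ∀ {P Q} ps → P ≗ Q → W P ps ≗ W Q ps
  W-cong ps e = W-congᴬ ps (All.universal e ps)

  W-0 : ∀ P ps → W P ps 0 ≡ 1
  W-0 P [] = refl
  W-0 P (p ∷ ps) = cong₂ _+_ (W-0 P ps) (*-zeroʳ ⟦ P p ⟧)

  private
    Entry = Vec ℕ d × ℕ

    related : Entry → Entry → Bool
    related e f = (proj₂ e ≡ᵇ 0) ∨ (proj₂ f ≡ᵇ 0) ∨ comp (proj₁ e) (proj₁ f)

    related-sym : ∀ e f → related e f ≡ related f e
    related-sym (p , u) (q , v) rewrite comp-sym p q = lem (u ≡ᵇ 0) (v ≡ᵇ 0) (comp q p)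
      where
      lem : ∀ a b c → a ∨ b ∨ c ≡ b ∨ a ∨ c
      lem true true c = refl
      lem true false c = refl
      lem false true c = refl
      lem false false c = refl

    related-refl : ∀ e → related e e ≡ true
    related-refl (p , u) rewrite comp-refl p = lem (u ≡ᵇ 0)
      where
      lem : ∀ a → a ∨ a ∨ true ≡ true
      lem true = refl
      lem false = refl

  -- `widthOne` tests all ordered pairs, the diagonal included. Reflexivity and symmetry of
  -- `related` discard the redundant tests.
  widthOne-∷ : ∀ t T → widthOne (t ∷ T) ≡ all (related t) T ∧ widthOne T
  widthOne-∷ t T = begin
    (related t t ∧ all (related t) T) ∧ all (λ e → related e t ∧ all (related e) T) T
      ≡⟨ cong₂ (λ a b → (a ∧ all (related t) T) ∧ b) (related-refl t)
           (trans (all-∧ (λ e → related e t) (λ e → all (related e) T) T)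
                  (cong (_∧ widthOne T) (all-cong T (λ e → related-sym e t)))) ⟩
    all (related t) T ∧ (all (related t) T ∧ widthOne T)
      ≡⟨ ∧-assoc (all (related t) T) _ _ ⟨
    (all (related t) T ∧ all (related t) T) ∧ widthOne T
      ≡⟨ cong (_∧ widthOne T) (∧-idem (all (related t) T)) ⟩
    all (related t) T ∧ widthOne T ∎

  supp⊆ : (Vec ℕ d → Bool) → Tensor d → Bool
  supp⊆ P = all (λ e → (proj₂ e ≡ᵇ 0) ∨ P (proj₁ e))

  ok : (Vec ℕ d → Bool) → Tensor d → Bool
  ok P T = widthOne T ∧ supp⊆ P T

  ok-zero : ∀ P p T → ok P ((p , 0) ∷ T) ≡ ok P T
  ok-zero P p T = cong (_∧ supp⊆ P T)
    (trans (widthOne-∷ (p , 0) T) (cong (_∧ widthOne T) (all-true T)))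

  -- For a nonzero entry at `p`, its relation to a later entry and the support condition on that
  -- entry are both void at value 0, so they merge into the single support condition `P ∩ p`.
  ok-suc : ∀ P p v T → ok P ((p , suc v) ∷ T) ≡ P p ∧ ok (P ∩ p) T
  ok-suc P p v T = begin
    widthOne ((p , suc v) ∷ T) ∧ (P p ∧ supp⊆ P T)
      ≡⟨ cong (_∧ (P p ∧ supp⊆ P T)) (widthOne-∷ (p , suc v) T) ⟩
    (all (related (p , suc v)) T ∧ widthOne T) ∧ (P p ∧ supp⊆ P T)
      ≡⟨ shuffle (all (related (p , suc v)) T) (widthOne T) (P p) (supp⊆ P T) ⟩
    P p ∧ (widthOne T ∧ (all (related (p , suc v)) T ∧ supp⊆ P T))
      ≡⟨ cong (λ b → P p ∧ (widthOne T ∧ b)) (trans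
           (sym (all-∧ (related (p , suc v)) _ T))
           (all-cong T (λ e → merge (proj₂ e ≡ᵇ 0) (comp p (proj₁ e)) (P (proj₁ e))))) ⟩
    P p ∧ ok (P ∩ p) T ∎
    where
    shuffle : ∀ a w p s → (a ∧ w) ∧ (p ∧ s) ≡ p ∧ (w ∧ (a ∧ s))
    shuffle false false false s = refl
    shuffle false false true s = refl
    shuffle false true false s = refl
    shuffle false true true s = refl
    shuffle true false false s = refl
    shuffle true false true s = refl
    shuffle true true false s = refl
    shuffle true true true s = refl
    merge : ∀ z c p → (z ∨ c) ∧ (z ∨ p) ≡ z ∨ (p ∧ c)
    merge true c p = refl
    merge false c p = ∧-comm c p

  byTotal : List (Tensor d) → (Tensor d → ℕ) → ℕ → ℕ
  byTotal Ts g s = ∑ Ts (λ T → g T * ⟦ total T ≡ᵇ s ⟧)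

  byTotal-zero : ∀ (Ts : List (Tensor d)) (g : Tensor d → ℕ) v → ∑ Ts (λ T → g T * ⟦ suc v + total T ≡ᵇ 0 ⟧) ≡ 0
  byTotal-zero Ts g v = trans (∑-cong Ts (λ T → *-zeroʳ (g T))) (∑-zero Ts)

  -- A positive first entry contributes t + t^2 + ... = t/(1 - t). The cap `B` loses nothing because
  -- an entry cannot exceed the total `s`.
  ∑-firstEntry : ∀ Ts g B s → s ≤ B →
    ∑ (upTo B) (λ v → ∑ Ts (λ T → g T * ⟦ suc v + total T ≡ᵇ s ⟧)) ≡ sg (byTotal Ts g) s
  ∑-firstEntry Ts g B zero s≤B =
    trans (∑-cong (upTo B) (byTotal-zero Ts g)) (∑-zero (upTo B))
  ∑-firstEntry Ts g (suc B) (suc s) (s≤s s≤B) = trans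
    (∑-upTo-suc B (λ v → ∑ Ts (λ T → g T * ⟦ suc v + total T ≡ᵇ suc s ⟧)))
    (cong (byTotal Ts g s +_) (∑-firstEntry Ts g B s s≤B))

  -- With the entry as weight the factor is t + 2t^2 + 3t^3 + ... = t/(1 - t) · (1 + t/(1 - t)).
  ∑-firstEntry-weighted : ∀ Ts g B s → s ≤ B →
    ∑ (upTo B) (λ v → suc v * ∑ Ts (λ T → g T * ⟦ suc v + total T ≡ᵇ s ⟧))
      ≡ sg (λ n → byTotal Ts g n + sg (byTotal Ts g) n) s
  ∑-firstEntry-weighted Ts g B zero s≤B = trans
    (∑-cong (upTo B) (λ v → trans (cong (suc v *_) (byTotal-zero Ts g v)) (*-zeroʳ (suc v))))
    (∑-zero (upTo B))
  ∑-firstEntry-weighted Ts g (suc B) (suc s) (s≤s s≤B) = begin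
    ∑ (upTo (suc B)) (λ v → suc v * F v (suc s))
      ≡⟨ ∑-upTo-suc B (λ v → suc v * F v (suc s)) ⟩
    -- Lowering entry and total by one turns `F (suc v) (suc s)` into `F v s`; its weight v + 2 is
    -- split as 1 + (v + 1).
    1 * N s + ∑ (upTo B) (λ v → F v s + suc v * F v s)
      ≡⟨ cong (1 * N s +_) (∑-+ (upTo B) (λ v → F v s) (λ v → suc v * F v s)) ⟩
    1 * N s + (∑ (upTo B) (λ v → F v s) + ∑ (upTo B) (λ v → suc v * F v s))
      ≡⟨ cong₂ (λ a b → 1 * N s + (a + b)) (∑-firstEntry Ts g B s s≤B)
               (∑-firstEntry-weighted Ts g B s s≤B) ⟩
    1 * N s + (sg N s + sg (λ n → N n + sg N n) s)
      ≡⟨ regroup (N s) (sg N s) _ ⟩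
    N s + sg N s + sg (λ n → N n + sg N n) s ∎
    where
    N = byTotal Ts g
    F : ℕ → ℕ → ℕ
    F v s = ∑ Ts (λ T → g T * ⟦ suc v + total T ≡ᵇ s ⟧)
    regroup : ∀ a b c → 1 * a + (b + c) ≡ a + b + c
    regroup = solve-∀

  ∑-assignments : ∀ p ps B (f : Tensor d → ℕ) →
    ∑ (assignments (p ∷ ps) B) f ≡
    ∑ (assignments ps B) (λ T → f ((p , 0) ∷ T)) +
    ∑ (upTo B) (λ v → ∑ (assignments ps B) (λ T → f ((p , suc v) ∷ T)))
  ∑-assignments p ps B f = begin
    ∑ (assignments (p ∷ ps) B) f
      ≡⟨ ∑-concatMap (λ v → map ((p , v) ∷_) (assignments ps B)) (upTo (suc B)) f ⟩
    ∑ (upTo (suc B)) (λ v → ∑ (map ((p , v) ∷_) (assignments ps B)) f)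
      ≡⟨ ∑-cong (upTo (suc B)) (λ v → ∑-map ((p , v) ∷_) (assignments ps B) f) ⟩
    ∑ (upTo (suc B)) (λ v → ∑ (assignments ps B) (λ T → f ((p , v) ∷ T)))
      ≡⟨ ∑-upTo-suc B (λ v → ∑ (assignments ps B) (λ T → f ((p , v) ∷ T))) ⟩
    _ ∎

  -- The cap on entries is kept apart from the total: the recursion lowers the total of the
  -- remaining tensor while the cap stays fixed.
  count-ok : ∀ P ps B s → s ≤ B → byTotal (assignments ps B) (λ T → ⟦ ok P T ⟧) s ≡ W P ps s
  count-ok P [] B zero s≤B = refl
  count-ok P [] B (suc s) s≤B = refl
  count-ok P (p ∷ ps) B s s≤B = begin
    byTotal (assignments (p ∷ ps) B) (λ T → ⟦ ok P T ⟧) s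
      ≡⟨ ∑-assignments p ps B (λ T → ⟦ ok P T ⟧ * ⟦ total T ≡ᵇ s ⟧) ⟩
    ∑ Ts (λ T → ⟦ ok P ((p , 0) ∷ T) ⟧ * ⟦ total T ≡ᵇ s ⟧) +
    ∑ (upTo B) (λ v → ∑ Ts (λ T → ⟦ ok P ((p , suc v) ∷ T) ⟧ * ⟦ suc v + total T ≡ᵇ s ⟧))
      ≡⟨ cong₂ _+_
           (trans (∑-cong Ts (λ T → cong (λ b → ⟦ b ⟧ * ⟦ total T ≡ᵇ s ⟧) (ok-zero P p T)))
                  (count-ok P ps B s s≤B))
           (trans (∑-cong (upTo B) (λ v → trans
                    (∑-cong Ts (λ T → trans
                      (cong (_* ⟦ suc v + total T ≡ᵇ s ⟧)
                        (trans (cong ⟦_⟧ (ok-suc P p v T)) (⟦⟧-∧ (P p) _)))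
                      (*-assoc ⟦ P p ⟧ _ _)))
                    (∑-*ˡ Ts ⟦ P p ⟧ _)))
                  (∑-*ˡ (upTo B) ⟦ P p ⟧ _)) ⟩
    W P ps s + ⟦ P p ⟧ * ∑ (upTo B) (λ v → ∑ Ts (λ T → ⟦ ok (P ∩ p) T ⟧ * ⟦ suc v + total T ≡ᵇ s ⟧))
      ≡⟨ cong (λ k → W P ps s + ⟦ P p ⟧ * k) (trans
           (∑-firstEntry Ts (λ T → ⟦ ok (P ∩ p) T ⟧) B s s≤B)
           (sg-cong-< s (λ i i<s → count-ok (P ∩ p) ps B i (≤-trans (<⇒≤ i<s) s≤B)))) ⟩
    W P (p ∷ ps) s ∎
    where Ts = assignments ps B

  component-∷ : ∀ p v (T : Tensor d) x → component ((p , v) ∷ T) x ≡ ⟦ eqᵥ p x ⟧ * v + component T x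
  component-∷ p v T x with eqᵥ p x
  ... | true = cong (_+ component T x) (sym (*-identityˡ v))
  ... | false = refl

  module _ (x : Vec ℕ d) where

    -- The variant of `W` that weights each tensor by its component at `x`. A nonzero entry at `p`
    -- adds its own value when `p` is `x`, and the later entries add their part in any case.
    Wx : (Vec ℕ d → Bool) → List (Vec ℕ d) → ℕ → ℕ
    Wx P [] s = 0
    Wx P (p ∷ ps) s = Wx P ps s +
      ⟦ P p ⟧ * (⟦ eqᵥ p x ⟧ * sg (λ n → W (P ∩ p) ps n + sg (W (P ∩ p) ps) n) s
                 + sg (Wx (P ∩ p) ps) s)

    component-ok : ∀ P ps B s → s ≤ B →
      byTotal (assignments ps B) (λ T → ⟦ ok P T ⟧ * component T x) s ≡ Wx P ps s
    component-ok P [] B s s≤B = refl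
    component-ok P (p ∷ ps) B s s≤B = begin
      byTotal (assignments (p ∷ ps) B) (λ T → ⟦ ok P T ⟧ * component T x) s
        ≡⟨ ∑-assignments p ps B (λ T → ⟦ ok P T ⟧ * component T x * ⟦ total T ≡ᵇ s ⟧) ⟩
      ∑ Ts (λ T → ⟦ ok P ((p , 0) ∷ T) ⟧ * component ((p , 0) ∷ T) x * ⟦ total T ≡ᵇ s ⟧) +
      ∑ (upTo B) (λ v → ∑ Ts (λ T →
        ⟦ ok P ((p , suc v) ∷ T) ⟧ * component ((p , suc v) ∷ T) x * ⟦ suc v + total T ≡ᵇ s ⟧))
        ≡⟨ cong₂ _+_
             (trans (∑-cong Ts (λ T → cong₂ (λ b c → ⟦ b ⟧ * c * ⟦ total T ≡ᵇ s ⟧)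
                      (ok-zero P p T)
                      (trans (component-∷ p 0 T x)
                             (cong (_+ component T x) (*-zeroʳ ⟦ eqᵥ p x ⟧)))))
                    (component-ok P ps B s s≤B))
             (trans (∑-cong (upTo B) inner)
                    (trans (∑-*ˡ (upTo B) ⟦ P p ⟧ _)
                      (cong (⟦ P p ⟧ *_) (trans (∑-+ (upTo B) (λ v → ⟦ eqᵥ p x ⟧ * (suc v * F v)) G)
                        (cong (_+ ∑ (upTo B) G) (∑-*ˡ (upTo B) ⟦ eqᵥ p x ⟧ (λ v → suc v * F v))))))) ⟩
      Wx P ps s + ⟦ P p ⟧ * (⟦ eqᵥ p x ⟧ * ∑ (upTo B) (λ v → suc v * F v) + ∑ (upTo B) G)
        ≡⟨ cong₂ (λ a b → Wx P ps s + ⟦ P p ⟧ * (⟦ eqᵥ p x ⟧ * a + b))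
             (trans (∑-firstEntry-weighted Ts g B s s≤B)
                    (sg-cong-< s (λ i i<s → cong₂ _+_ (N≡W i (<⇒≤ i<s))
                      (sg-cong-< i (λ j j<i → N≡W j (<⇒≤ (<-trans j<i i<s)))))))
             (trans (∑-firstEntry Ts g′ B s s≤B)
                    (sg-cong-< s (λ i i<s → component-ok (P ∩ p) ps B i (≤-trans (<⇒≤ i<s) s≤B)))) ⟩
      Wx P (p ∷ ps) s ∎
      where
      Ts = assignments ps B
      g g′ : Tensor d → ℕ
      g T = ⟦ ok (P ∩ p) T ⟧
      g′ T = ⟦ ok (P ∩ p) T ⟧ * component T x
      F G : ℕ → ℕ
      F v = ∑ Ts (λ T → g T * ⟦ suc v + total T ≡ᵇ s ⟧)
      G v = ∑ Ts (λ T → g′ T * ⟦ suc v + total T ≡ᵇ s ⟧)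
      N≡W : ∀ i → i ≤ s → byTotal Ts g i ≡ W (P ∩ p) ps i
      N≡W i i≤s = count-ok (P ∩ p) ps B i (≤-trans i≤s s≤B)
      expand : ∀ a b e v c t → a * b * (e * v + c) * t ≡ a * (e * (v * (b * t)) + b * c * t)
      expand = solve-∀
      inner : ∀ v → ∑ Ts (λ T → ⟦ ok P ((p , suc v) ∷ T) ⟧ * component ((p , suc v) ∷ T) x
                                * ⟦ suc v + total T ≡ᵇ s ⟧)
                    ≡ ⟦ P p ⟧ * (⟦ eqᵥ p x ⟧ * (suc v * F v) + G v)
      inner v = begin
        _ ≡⟨ ∑-cong Ts (λ T → trans
               (cong₂ (λ b c → b * c * ⟦ suc v + total T ≡ᵇ s ⟧)
                 (trans (cong ⟦_⟧ (ok-suc P p v T)) (⟦⟧-∧ (P p) _)) (component-∷ p (suc v) T x))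
               (expand ⟦ P p ⟧ (g T) ⟦ eqᵥ p x ⟧ (suc v) (component T x) ⟦ suc v + total T ≡ᵇ s ⟧)) ⟩
        ∑ Ts (λ T → ⟦ P p ⟧ * (⟦ eqᵥ p x ⟧ * (suc v * (g T * τ T)) + g′ T * τ T))
          ≡⟨ ∑-*ˡ Ts ⟦ P p ⟧ _ ⟩
        ⟦ P p ⟧ * ∑ Ts (λ T → ⟦ eqᵥ p x ⟧ * (suc v * (g T * τ T)) + g′ T * τ T)
          ≡⟨ cong (⟦ P p ⟧ *_) (trans (∑-+ Ts (λ T → ⟦ eqᵥ p x ⟧ * (suc v * (g T * τ T))) (λ T → g′ T * τ T))
               (cong (_+ G v) (trans (∑-*ˡ Ts ⟦ eqᵥ p x ⟧ (λ T → suc v * (g T * τ T)))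
                 (cong (⟦ eqᵥ p x ⟧ *_) (∑-*ˡ Ts (suc v) (λ T → g T * τ T)))))) ⟩
        ⟦ P p ⟧ * (⟦ eqᵥ p x ⟧ * (suc v * F v) + G v) ∎
        where
        τ : Tensor d → ℕ
        τ T = ⟦ suc v + total T ≡ᵇ s ⟧

    multiplicity : List (Vec ℕ d) → ℕ
    multiplicity ps = ∑ ps (λ p → ⟦ eqᵥ p x ⟧)

    Wx-absent : ∀ P ps → multiplicity ps ≡ 0 → ∀ s → Wx P ps s ≡ 0
    Wx-absent P [] _ s = refl
    Wx-absent P (p ∷ ps) m s with eqᵥ p x
    ... | false = cong₂ _+_ (Wx-absent P ps m s)
            (trans (cong (⟦ P p ⟧ *_) (sg-zero (Wx-absent (P ∩ p) ps m) s)) (*-zeroʳ ⟦ P p ⟧))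

    -- Lowering T[x] by one shows that T[x] counts the ways of writing
    -- T = (positive multiple of x) + (tensor supported on points comparable to x).
    Wx-once : ∀ P ps → multiplicity ps ≡ 1 → ∀ s → Wx P ps s ≡ ⟦ P x ⟧ * sg (W (P ∩ x) ps) s
    Wx-once P (p ∷ ps) m s with eqᵥ p x in eq
    ... | true with refl ← true-eq p x eq = begin
      Wx P ps s + ⟦ P x ⟧ * (1 * sg (λ n → W (P ∩ x) ps n + sg (W (P ∩ x) ps) n) s + sg (Wx (P ∩ x) ps) s)
        ≡⟨ cong₂ _+_ (Wx-absent P ps (suc-injective m) s)
             (cong (⟦ P x ⟧ *_) (cong₂ _+_ (*-identityˡ _) (sg-zero (Wx-absent (P ∩ x) ps (suc-injective m)) s))) ⟩
      ⟦ P x ⟧ * (sg (λ n → W (P ∩ x) ps n + sg (W (P ∩ x) ps) n) s + 0)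
        ≡⟨ cong (⟦ P x ⟧ *_) (+-identityʳ _) ⟩
      ⟦ P x ⟧ * sg (λ n → W (P ∩ x) ps n + sg (W (P ∩ x) ps) n) s
        ≡⟨ absorb (P x) refl ⟩
      ⟦ P x ⟧ * sg (W (P ∩ x) (x ∷ ps)) s ∎
      where
      -- Restricting to points comparable with `x` twice changes nothing, so the added `sg` term is
      -- exactly what putting `x` back into the list contributes to `W`.
      absorb : ∀ b → P x ≡ b →
        ⟦ b ⟧ * sg (λ n → W (P ∩ x) ps n + sg (W (P ∩ x) ps) n) s ≡ ⟦ b ⟧ * sg (W (P ∩ x) (x ∷ ps)) s
      absorb false _ = refl
      absorb true Px = cong (1 *_) (sg-cong (λ n → cong (W (P ∩ x) ps n +_) (begin
        sg (W (P ∩ x) ps) n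
          ≡⟨ sg-cong (W-cong ps (λ q → trans (cong (P q ∧_) (sym (∧-idem (comp x q))))
                                             (sym (∧-assoc (P q) _ _)))) n ⟩
        sg (W ((P ∩ x) ∩ x) ps) n
          ≡⟨ *-identityˡ _ ⟨
        1 * sg (W ((P ∩ x) ∩ x) ps) n
          ≡⟨ cong (λ b → ⟦ b ⟧ * sg (W ((P ∩ x) ∩ x) ps) n) (cong₂ _∧_ Px (comp-refl x)) ⟨
        ⟦ (P ∩ x) x ⟧ * sg (W ((P ∩ x) ∩ x) ps) n ∎)) s)
    -- The restrictions imposed by `p` and by `x` commute and `comp` is symmetric, so the choice at
    -- `p` may be made after the one at `x`.
    Wx-once P (p ∷ ps) m s | false = begin
      Wx P ps s + ⟦ P p ⟧ * sg (Wx (P ∩ p) ps) s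
        ≡⟨ cong₂ (λ a b → a + ⟦ P p ⟧ * b) (Wx-once P ps m s)
             (trans (sg-cong (Wx-once (P ∩ p) ps m) s) (sg-*ˡ ⟦ (P ∩ p) x ⟧ _ s)) ⟩
      ⟦ P x ⟧ * sg (W (P ∩ x) ps) s + ⟦ P p ⟧ * (⟦ (P ∩ p) x ⟧ * sg (sg (W ((P ∩ p) ∩ x) ps)) s)
        ≡⟨ cong (λ k → ⟦ P x ⟧ * sg (W (P ∩ x) ps) s + ⟦ P p ⟧ * (⟦ (P ∩ p) x ⟧ * k))
             (sg-cong (sg-cong (W-cong ps (λ q → swap (P q) (comp p q) (comp x q)))) s) ⟩
      ⟦ P x ⟧ * sg (W (P ∩ x) ps) s + ⟦ P p ⟧ * (⟦ (P ∩ p) x ⟧ * Y)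
        ≡⟨ cong (⟦ P x ⟧ * sg (W (P ∩ x) ps) s +_) (begin
             ⟦ P p ⟧ * (⟦ P x ∧ comp p x ⟧ * Y)
               ≡⟨ cong (λ k → ⟦ P p ⟧ * (k * Y)) (⟦⟧-∧ (P x) (comp p x)) ⟩
             ⟦ P p ⟧ * (⟦ P x ⟧ * ⟦ comp p x ⟧ * Y)
               ≡⟨ move ⟦ P p ⟧ ⟦ P x ⟧ ⟦ comp p x ⟧ Y ⟩
             ⟦ P x ⟧ * (⟦ P p ⟧ * ⟦ comp p x ⟧ * Y)
               ≡⟨ cong (λ k → ⟦ P x ⟧ * (k * Y)) (⟦⟧-∧ (P p) (comp p x)) ⟨
             ⟦ P x ⟧ * (⟦ P p ∧ comp p x ⟧ * Y)
               ≡⟨ cong (λ c → ⟦ P x ⟧ * (⟦ P p ∧ c ⟧ * Y)) (comp-sym p x) ⟩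
             ⟦ P x ⟧ * (⟦ (P ∩ x) p ⟧ * Y) ∎) ⟩
      ⟦ P x ⟧ * sg (W (P ∩ x) ps) s + ⟦ P x ⟧ * (⟦ (P ∩ x) p ⟧ * Y)
        ≡⟨ *-distribˡ-+ ⟦ P x ⟧ _ _ ⟨
      ⟦ P x ⟧ * (sg (W (P ∩ x) ps) s + ⟦ (P ∩ x) p ⟧ * Y)
        ≡⟨ cong (⟦ P x ⟧ *_) (trans (cong (sg (W (P ∩ x) ps) s +_)
                                       (sym (sg-*ˡ ⟦ (P ∩ x) p ⟧ (sg (W ((P ∩ x) ∩ p) ps)) s)))
                                    (sym (sg-+ (W (P ∩ x) ps) _ s))) ⟩
      ⟦ P x ⟧ * sg (W (P ∩ x) (p ∷ ps)) s ∎
      where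
      Y = sg (sg (W ((P ∩ x) ∩ p) ps)) s
      swap : ∀ a b c → (a ∧ b) ∧ c ≡ (a ∧ c) ∧ b
      swap a b c = trans (∧-assoc a b c) (trans (cong (a ∧_) (∧-comm b c)) (sym (∧-assoc a c b)))
      move : ∀ a b c y → a * (b * c * y) ≡ b * (a * c * y)
      move = solve-∀

    Σ¹-W : ∀ n s → multiplicity (points n) ≡ 1 → Σ¹ n s x ≡ sg (W (comp x) (points n)) s
    Σ¹-W n s m = begin
      Σ¹ n s x
        ≡⟨ ∑-filterᵇ (λ T → widthOne T ∧ (total T ≡ᵇ s)) (assignments (points n) s) (λ T → component T x) ⟩
      ∑ (assignments (points n) s) (λ T → ⟦ widthOne T ∧ (total T ≡ᵇ s) ⟧ * component T x)
        ≡⟨ ∑-cong (assignments (points n) s) (λ T → begin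
             ⟦ widthOne T ∧ (total T ≡ᵇ s) ⟧ * component T x
               ≡⟨ cong (_* component T x) (⟦⟧-∧ (widthOne T) _) ⟩
             ⟦ widthOne T ⟧ * ⟦ total T ≡ᵇ s ⟧ * component T x
               ≡⟨ swap ⟦ widthOne T ⟧ ⟦ total T ≡ᵇ s ⟧ (component T x) ⟩
             ⟦ widthOne T ⟧ * component T x * ⟦ total T ≡ᵇ s ⟧
               ≡⟨ cong (λ b → ⟦ b ⟧ * component T x * ⟦ total T ≡ᵇ s ⟧) (sym (everywhere T)) ⟩
             ⟦ ok (λ _ → true) T ⟧ * component T x * ⟦ total T ≡ᵇ s ⟧ ∎) ⟩
      byTotal (assignments (points n) s) (λ T → ⟦ ok (λ _ → true) T ⟧ * component T x) s
        ≡⟨ component-ok (λ _ → true) (points n) s s ≤-refl ⟩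
      Wx (λ _ → true) (points n) s
        ≡⟨ Wx-once (λ _ → true) (points n) m s ⟩
      1 * sg (W (comp x) (points n)) s
        ≡⟨ *-identityˡ _ ⟩
      sg (W (comp x) (points n)) s ∎
      where
      swap : ∀ a b c → a * b * c ≡ a * c * b
      swap = solve-∀
      everywhere : ∀ T → ok (λ _ → true) T ≡ widthOne T
      everywhere T = trans
        (cong (widthOne T ∧_) (trans (all-cong T (λ e → ∨-zeroʳ (proj₂ e ≡ᵇ 0))) (all-true T)))
        (∧-identityʳ (widthOne T))

-- Cutting at a point, and removing the least point of a multichain

module _ {d : ℕ} where

  W-in : ∀ (P : Vec ℕ d → Bool) p ps → P p ≡ true → W P (p ∷ ps) ≗ (λ s → W P ps s + sg (W (P ∩ p) ps) s)
  W-in P p ps e s rewrite e = cong (W P ps s +_) (*-identityˡ _)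

  W-out : ∀ (P : Vec ℕ d → Bool) p ps → P p ≡ false → W P (p ∷ ps) ≗ W P ps
  W-out P p ps e s rewrite e = +-identityʳ _

  W-empty : ∀ (P : Vec ℕ d → Bool) ps → All (λ q → P q ≡ false) ps → W P ps ≗ δ
  W-empty P [] [] s = refl
  W-empty P (p ∷ ps) (e ∷ es) s = trans (W-out P p ps e s) (W-empty P ps es s)

  -- As every point of `A` is comparable with every point of `B`, choosing a point of one set
  -- restricts only that set; a chain in the union is an arbitrary pair of chains.
  W-∨ : ∀ (A B : Vec ℕ d → Bool) ps → (∀ q → A q ≡ true → B q ≡ false) →
    (∀ q r → A q ≡ true → B r ≡ true → comp q r ≡ true) →
    W (λ q → A q ∨ B q) ps ≗ conv (W A ps) (W B ps)
  W-∨ A B [] dis cmp s = sym (conv-δˡ δ s)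
  W-∨ A B (p ∷ ps) dis cmp s = go (A p) (B p) refl refl
    where
    A∨B : Vec ℕ d → Bool
    A∨B q = A q ∨ B q
    absorbˡ : ∀ a b c → (b ≡ true → c ≡ true) → (a ∨ b) ∧ c ≡ (a ∧ c) ∨ b
    absorbˡ a true c f rewrite f refl = trans (∧-identityʳ _) (cong (_∨ true) (sym (∧-identityʳ a)))
    absorbˡ a false c f rewrite ∨-identityʳ a = sym (∨-identityʳ _)
    absorbʳ : ∀ a b c → (a ≡ true → c ≡ true) → (a ∨ b) ∧ c ≡ a ∨ (b ∧ c)
    absorbʳ true b c f = f refl
    absorbʳ false b c f = refl
    go : ∀ a b → A p ≡ a → B p ≡ b → W A∨B (p ∷ ps) s ≡ conv (W A (p ∷ ps)) (W B (p ∷ ps)) s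
    go true true Ap Bp with () ← trans (sym Bp) (dis p Ap)
    go true false Ap Bp = begin
      W A∨B (p ∷ ps) s
        ≡⟨ W-in A∨B p ps (cong₂ _∨_ Ap Bp) s ⟩
      W A∨B ps s + sg (W (A∨B ∩ p) ps) s
        ≡⟨ cong₂ _+_ (W-∨ A B ps dis cmp s) (sg-cong (λ i → trans
             (W-cong ps (λ q → absorbˡ (A q) (B q) (comp p q) (cmp p q Ap)) i)
             (W-∨ (A ∩ p) B ps (λ q e → dis q (∧-trueˡ e)) (λ q r e → cmp q r (∧-trueˡ e)) i)) s) ⟩
      conv (W A ps) (W B ps) s + sg (conv (W (A ∩ p) ps) (W B ps)) s
        ≡⟨ cong (conv (W A ps) (W B ps) s +_) (conv-sgˡ (W (A ∩ p) ps) (W B ps) s) ⟨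
      conv (W A ps) (W B ps) s + conv (sg (W (A ∩ p) ps)) (W B ps) s
        ≡⟨ conv-+ˡ (W A ps) (sg (W (A ∩ p) ps)) (W B ps) s ⟨
      conv (λ i → W A ps i + sg (W (A ∩ p) ps) i) (W B ps) s
        ≡⟨ conv-cong (W-in A p ps Ap) (W-out B p ps Bp) s ⟨
      conv (W A (p ∷ ps)) (W B (p ∷ ps)) s ∎
    go false true Ap Bp = begin
      W A∨B (p ∷ ps) s
        ≡⟨ W-in A∨B p ps (cong₂ _∨_ Ap Bp) s ⟩
      W A∨B ps s + sg (W (A∨B ∩ p) ps) s
        ≡⟨ cong₂ _+_ (W-∨ A B ps dis cmp s) (sg-cong (λ i → trans
             (W-cong ps (λ q → absorbʳ (A q) (B q) (comp p q) (λ e → trans (comp-sym p q) (cmp q p e Bp))) i)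
             (W-∨ A (B ∩ p) ps (λ q e → cong (_∧ comp p q) (dis q e))
               (λ q r e e′ → cmp q r e (∧-trueˡ e′)) i)) s) ⟩
      conv (W A ps) (W B ps) s + sg (conv (W A ps) (W (B ∩ p) ps)) s
        ≡⟨ cong₂ _+_ (conv-comm (W A ps) (W B ps) s)
             (trans (sym (conv-sgʳ (W A ps) (W (B ∩ p) ps) s)) (conv-comm (W A ps) _ s)) ⟩
      conv (W B ps) (W A ps) s + conv (sg (W (B ∩ p) ps)) (W A ps) s
        ≡⟨ conv-+ˡ (W B ps) (sg (W (B ∩ p) ps)) (W A ps) s ⟨
      conv (λ i → W B ps i + sg (W (B ∩ p) ps) i) (W A ps) s
        ≡⟨ conv-cong (W-in B p ps Bp) (W-out A p ps Ap) s ⟨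
      conv (W B (p ∷ ps)) (W A (p ∷ ps)) s
        ≡⟨ conv-comm (W B (p ∷ ps)) _ s ⟩
      conv (W A (p ∷ ps)) (W B (p ∷ ps)) s ∎
    go false false Ap Bp = begin
      W A∨B (p ∷ ps) s               ≡⟨ W-out A∨B p ps (cong₂ _∨_ Ap Bp) s ⟩
      W A∨B ps s                     ≡⟨ W-∨ A B ps dis cmp s ⟩
      conv (W A ps) (W B ps) s       ≡⟨ conv-cong (W-out A p ps Ap) (W-out B p ps Bp) s ⟨
      conv (W A (p ∷ ps)) (W B (p ∷ ps)) s ∎

  absent⇒All : ∀ (x : Vec ℕ d) ps → multiplicity x ps ≡ 0 → All (λ q → eqᵥ q x ≡ false) ps
  absent⇒All x [] _ = []
  absent⇒All x (p ∷ ps) m with eqᵥ p x in eq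
  ... | false = eq ∷ absent⇒All x ps m

  W-point : ∀ (x : Vec ℕ d) ps → multiplicity x ps ≡ 1 → W (λ q → eqᵥ q x) ps ≗ one
  W-point x (p ∷ ps) m s with eqᵥ p x in eq
  ... | false = trans (+-identityʳ _) (W-point x ps m s)
  ... | true = begin
    W ≡x ps s + 1 * sg (W (≡x ∩ p) ps) s
      ≡⟨ cong₂ _+_ (W-empty ≡x ps none s)
           (trans (*-identityˡ _) (sg-cong (W-empty (≡x ∩ p) ps (All.map (λ {q} → cong (_∧ comp p q)) none)) s)) ⟩
    δ s + sg δ s     ≡⟨ conv-one δ s ⟨
    conv one δ s     ≡⟨ conv-comm one δ s ⟩
    conv δ one s     ≡⟨ conv-δˡ one s ⟩
    one s            ∎
    where
    ≡x : Vec ℕ d → Bool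
    ≡x q = eqᵥ q x
    none = absent⇒All x ps (suc-injective m)

  -- The points comparable with `x` are those strictly below it and those above or equal. The factor
  -- t/(1 - t) of `sg` splits: t accounts for the index shift, and 1/(1 - t) is the enumerator of
  -- the single point `x`, which restores `x` to the lower part. Hence `x` belongs to both factors
  -- on the right.
  sg-W-comp : ∀ (x : Vec ℕ d) ps → multiplicity x ps ≡ 1 → ∀ s →
    sg (W (comp x) ps) (suc s) ≡ conv (W (λ q → leqᵥ q x) ps) (W (leqᵥ x) ps) s
  sg-W-comp x ps m s = begin
    sg (W (comp x) ps) (suc s)
      ≡⟨ sg-suc (W (comp x) ps) s ⟩
    conv one (W (comp x) ps) s
      ≡⟨ conv-cong {one} (λ _ → refl) (λ i → trans
           (W-cong ps (λ q → cases (leqᵥ x q) (leqᵥ q x)) i)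
           (W-∨ below (leqᵥ x) ps (λ q → not-above (leqᵥ x q) (leqᵥ q x))
             (λ q r e f → cong (_∨ leqᵥ r q) (leq-trans q x r (∧-trueˡ e) f)) i)) s ⟩
    conv one (conv (W below ps) (W (leqᵥ x) ps)) s
      ≡⟨ conv-assoc one (W below ps) _ s ⟨
    conv (conv one (W below ps)) (W (leqᵥ x) ps) s
      ≡⟨ conv-cong {g = W (leqᵥ x) ps} (λ i → trans (conv-comm one (W below ps) i) (sym (W-down i))) (λ _ → refl) s ⟩
    conv (W (λ q → leqᵥ q x) ps) (W (leqᵥ x) ps) s ∎
    where
    below : Vec ℕ d → Bool
    below q = leqᵥ q x ∧ not (leqᵥ x q)
    cases : ∀ a b → a ∨ b ≡ (b ∧ not a) ∨ a
    cases true b = sym (∨-zeroʳ _)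
    cases false true = refl
    cases false false = refl
    not-above : ∀ a b → b ∧ not a ≡ true → a ≡ false
    not-above false b e = refl
    not-above true false ()
    not-above true true ()
    split : ∀ q → leqᵥ q x ≡ below q ∨ eqᵥ q x
    split q with leqᵥ q x in e | leqᵥ x q in f | eqᵥ q x in g
    ... | true | false | _ = refl
    ... | true | true | true = refl
    ... | false | _ | false = refl
    ... | true | true | false with refl ← leq-antisym q x e f with () ← trans (sym (eq-refl x)) g
    ... | false | _ | true with refl ← true-eq q x g with () ← trans (sym (leq-refl x)) e
    below≢ : ∀ q → below q ≡ true → eqᵥ q x ≡ false
    below≢ q e with eqᵥ q x in g
    ... | false = refl
    ... | true with refl ← true-eq q x g
      with () ← trans (sym (not-above (leqᵥ x x) (leqᵥ x x) e)) (leq-refl x)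
    W-down : W (λ q → leqᵥ q x) ps ≗ conv (W below ps) one
    W-down i = begin
      W (λ q → leqᵥ q x) ps i
        ≡⟨ W-cong ps split i ⟩
      W (λ q → below q ∨ eqᵥ q x) ps i
        ≡⟨ W-∨ below (λ q → eqᵥ q x) ps below≢
             (λ q r e f → cong (_∨ leqᵥ r q)
               (trans (cong (leqᵥ q) (true-eq r x f)) (∧-trueˡ e))) i ⟩
      conv (W below ps) (W (λ q → eqᵥ q x) ps) i
        ≡⟨ conv-cong {W below ps} (λ _ → refl) (W-point x ps m) i ⟩
      conv (W below ps) one i ∎

  -- A linear extension of the order without repetitions: nothing later in the list lies below or
  -- equals an earlier point.
  Sorted : List (Vec ℕ d) → Set
  Sorted = AllPairs (λ p q → leqᵥ q p ≡ false)

  -- Splits off the least point of a nonempty multichain.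
  W-suc : ∀ P ps → Sorted ps → ∀ s →
    W P ps (suc s) ≡ ∑ ps (λ p → ⟦ P p ⟧ * W (λ q → P q ∧ leqᵥ p q) ps s)
  W-suc P [] [] s = refl
  W-suc P (p ∷ ps) (p< ∷ srt) s = begin
    W P ps (suc s) + ⟦ P p ⟧ * sg (W (P ∩ p) ps) (suc s)
      ≡⟨ +-comm (W P ps (suc s)) _ ⟩
    ⟦ P p ⟧ * sg (W (P ∩ p) ps) (suc s) + W P ps (suc s)
      ≡⟨ cong₂ _+_ (head (P p) refl) (trans (W-suc P ps srt s) (∑-congᴬ (All.map tail p<))) ⟩
    ∑ (p ∷ ps) (λ p′ → ⟦ P p′ ⟧ * W (λ q → P q ∧ leqᵥ p′ q) (p ∷ ps) s) ∎
    where
    tail : ∀ {q} → leqᵥ q p ≡ false →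
      ⟦ P q ⟧ * W (λ r → P r ∧ leqᵥ q r) ps s ≡ ⟦ P q ⟧ * W (λ r → P r ∧ leqᵥ q r) (p ∷ ps) s
    tail {q} e = cong (⟦ P q ⟧ *_)
      (sym (W-out (λ r → P r ∧ leqᵥ q r) p ps (trans (cong (P p ∧_) e) (∧-zeroʳ (P p))) s))
    P≥ : Vec ℕ d → Bool
    P≥ q = P q ∧ leqᵥ p q
    -- No later point is below `p`, so comparable with `p` means above it.
    same : W (P ∩ p) ps ≗ W P≥ ps
    same = W-congᴬ ps (All.map (λ {q} e → cong (P q ∧_) (trans (cong (leqᵥ p q ∨_) e) (∨-identityʳ _))) p<)
    same′ : W (P≥ ∩ p) ps ≗ W P≥ ps
    same′ = W-cong ps (λ q → lem (P q) (leqᵥ p q) (leqᵥ q p))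
      where
      lem : ∀ a b c → (a ∧ b) ∧ (b ∨ c) ≡ a ∧ b
      lem false b c = refl
      lem true false c = refl
      lem true true c = refl
    head : ∀ b → P p ≡ b → ⟦ b ⟧ * sg (W (P ∩ p) ps) (suc s) ≡ ⟦ b ⟧ * W P≥ (p ∷ ps) s
    head false _ = refl
    -- One copy of `p` is taken away; `p` may still occur in what remains, so it stays in the list
    -- on the right.
    head true Pp = cong (1 *_) (begin
      W (P ∩ p) ps s + sg (W (P ∩ p) ps) s
        ≡⟨ cong₂ _+_ (same s) (sg-cong same s) ⟩
      W P≥ ps s + sg (W P≥ ps) s
        ≡⟨ cong (W P≥ ps s +_) (sg-cong same′ s) ⟨
      W P≥ ps s + sg (W (P≥ ∩ p) ps) s
        ≡⟨ W-in P≥ p ps (cong₂ _∧_ Pp (leq-refl p)) s ⟨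
      W P≥ (p ∷ ps) s ∎)

-- Multichains in intervals of a product of chains

∑-points : ∀ {d} m (n : Vec ℕ d) f →
  ∑ (points (m V.∷ n)) f ≡ ∑ (upTo m) (λ i → ∑ (points n) (λ p → f (suc i V.∷ p)))
∑-points m n f = begin
  ∑ (points (m V.∷ n)) f
    ≡⟨ ∑-concatMap (λ a → map (a V.∷_) (points n)) (range1 m) f ⟩
  ∑ (range1 m) (λ a → ∑ (map (a V.∷_) (points n)) f)
    ≡⟨ ∑-map suc (upTo m) _ ⟩
  ∑ (upTo m) (λ i → ∑ (map (suc i V.∷_) (points n)) f)
    ≡⟨ ∑-cong (upTo m) (λ i → ∑-map (suc i V.∷_) (points n) f) ⟩
  ∑ (upTo m) (λ i → ∑ (points n) (λ p → f (suc i V.∷ p))) ∎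

-- H₊ p s counts the multichains of length s in a product of chains with
-- p₁ + 1, …, p_d + 1 elements.
H₊ : ∀ {d} → Vec ℕ d → ℕ → ℕ
H₊ V.[] s = 1
H₊ (q V.∷ p) s = H q s * H₊ p s

H₊-0 : ∀ {d} (p : Vec ℕ d) → H₊ p 0 ≡ 1
H₊-0 V.[] = refl
H₊-0 (q V.∷ p) = cong₂ _*_ (H-0 q) (H₊-0 p)

suc-≤ᵇ : ∀ a i → (suc a ≤ᵇ suc i) ≡ (a ≤ᵇ i)
suc-≤ᵇ zero i = refl
suc-≤ᵇ (suc a) i = refl

-- The recursion of `H` is Pascal's rule and peels off the term i = a. The bound b < m keeps the
-- whole interval inside the range of summation.
hockey-stick : ∀ a b m s → a ≤ b → b < m →
  ∑ (upTo m) (λ i → ⟦ (a ≤ᵇ i) ∧ (i ≤ᵇ b) ⟧ * H (b ∸ i) s) ≡ H (b ∸ a) (suc s)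
hockey-stick zero zero (suc m) s a≤b b<m = trans (∑-upTo-suc m (λ i → ⟦ i ≤ᵇ 0 ⟧ * H (0 ∸ i) s))
  (cong suc (∑-zero (upTo m)))
hockey-stick zero (suc b) (suc m) s a≤b (s≤s b<m) = begin
  ∑ (upTo (suc m)) (λ i → ⟦ i ≤ᵇ suc b ⟧ * H (suc b ∸ i) s)
    ≡⟨ ∑-upTo-suc m (λ i → ⟦ i ≤ᵇ suc b ⟧ * H (suc b ∸ i) s) ⟩
  1 * H (suc b) s + ∑ (upTo m) (λ i → ⟦ suc i ≤ᵇ suc b ⟧ * H (b ∸ i) s)
    ≡⟨ cong₂ _+_ (*-identityˡ (H (suc b) s)) (trans
         (∑-cong (upTo m) (λ i → cong (λ c → ⟦ c ⟧ * H (b ∸ i) s) (suc-≤ᵇ i b)))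
         (hockey-stick zero b m s z≤n b<m)) ⟩
  H (suc b) (suc s) ∎
hockey-stick (suc a) (suc b) (suc m) s (s≤s a≤b) (s≤s b<m) = begin
  ∑ (upTo (suc m)) (λ i → ⟦ (suc a ≤ᵇ i) ∧ (i ≤ᵇ suc b) ⟧ * H (suc b ∸ i) s)
    ≡⟨ ∑-upTo-suc m (λ i → ⟦ (suc a ≤ᵇ i) ∧ (i ≤ᵇ suc b) ⟧ * H (suc b ∸ i) s) ⟩
  ∑ (upTo m) (λ i → ⟦ (suc a ≤ᵇ suc i) ∧ (suc i ≤ᵇ suc b) ⟧ * H (b ∸ i) s)
    ≡⟨ ∑-cong (upTo m) (λ i → cong (λ c → ⟦ c ⟧ * H (b ∸ i) s) (cong₂ _∧_ (suc-≤ᵇ a i) (suc-≤ᵇ i b))) ⟩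
  ∑ (upTo m) (λ i → ⟦ (a ≤ᵇ i) ∧ (i ≤ᵇ b) ⟧ * H (b ∸ i) s)
    ≡⟨ hockey-stick a b m s a≤b b<m ⟩
  H (b ∸ a) (suc s) ∎

between : ∀ {d} → Vec ℕ d → Vec ℕ d → Vec ℕ d → Bool
between a b q = leqᵥ a q ∧ leqᵥ q b

-- Here `p` is the least point of a multichain of length s + 1 in [a, b]. Indicator and summand both
-- factor over the coordinates, leaving one hockey-stick sum for each.
∑-interval : ∀ {d} (n a b : Vec ℕ d) s →
  leqᵥ (𝟏 d) a ≡ true → leqᵥ a b ≡ true → leqᵥ b n ≡ true →
  ∑ (points n) (λ p → ⟦ between a b p ⟧ * H₊ (b -ᵥ p) s) ≡ H₊ (b -ᵥ a) (suc s)
∑-interval V.[] V.[] V.[] s 1≤a a≤b b≤n = refl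
∑-interval (m V.∷ n) (zero V.∷ as) (β V.∷ bs) s () a≤b b≤n
∑-interval (m V.∷ n) (suc α V.∷ as) (zero V.∷ bs) s 1≤a () b≤n
∑-interval (m V.∷ n) (suc α V.∷ as) (suc β V.∷ bs) s 1≤a a≤b b≤n = begin
  ∑ (points (m V.∷ n)) (λ p → ⟦ between a b p ⟧ * H₊ (b -ᵥ p) s)
    ≡⟨ ∑-points m n (λ p → ⟦ between a b p ⟧ * H₊ (b -ᵥ p) s) ⟩
  ∑ (upTo m) (λ i → ∑ (points n) (λ p → ⟦ between a b (suc i V.∷ p) ⟧ * (H (β ∸ i) s * H₊ (bs -ᵥ p) s)))
    ≡⟨ ∑-cong (upTo m) (λ i → trans
         (∑-cong (points n) (λ p → factor (suc α ≤ᵇ suc i) (suc i ≤ᵇ suc β) (leqᵥ as p) (leqᵥ p bs) _ _))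
         (∑-*ˡ (points n) (⟦ (suc α ≤ᵇ suc i) ∧ (suc i ≤ᵇ suc β) ⟧ * H (β ∸ i) s) _)) ⟩
  ∑ (upTo m) (λ i → ⟦ (suc α ≤ᵇ suc i) ∧ (suc i ≤ᵇ suc β) ⟧ * H (β ∸ i) s * rest)
    ≡⟨ ∑-*ʳ (upTo m) rest _ ⟩
  ∑ (upTo m) (λ i → ⟦ (suc α ≤ᵇ suc i) ∧ (suc i ≤ᵇ suc β) ⟧ * H (β ∸ i) s) * rest
    ≡⟨ cong₂ _*_
         (trans (∑-cong (upTo m) (λ i → cong (λ c → ⟦ c ⟧ * H (β ∸ i) s) (cong₂ _∧_ (suc-≤ᵇ α i) (suc-≤ᵇ i β))))
                (hockey-stick α β m s (s≤s⁻¹ (true-≤ᵇ {suc α} {suc β} (∧-trueˡ a≤b))) (true-≤ᵇ {suc β} {m} (∧-trueˡ b≤n))))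
         (∑-interval n as bs s (∧-trueʳ {1 ≤ᵇ suc α} 1≤a) (∧-trueʳ {suc α ≤ᵇ suc β} a≤b) (∧-trueʳ {suc β ≤ᵇ m} b≤n)) ⟩
  H (β ∸ α) (suc s) * H₊ (bs -ᵥ as) (suc s) ∎
  where
  a = suc α V.∷ as
  b = suc β V.∷ bs
  rest = ∑ (points n) (λ p → ⟦ between as bs p ⟧ * H₊ (bs -ᵥ p) s)
  factor : ∀ p q r t u v → ⟦ (p ∧ r) ∧ (q ∧ t) ⟧ * (u * v) ≡ ⟦ p ∧ q ⟧ * u * (⟦ r ∧ t ⟧ * v)
  factor p q r t u v = trans
    (cong (_* (u * v)) (trans (cong ⟦_⟧ (swap p q r t)) (⟦⟧-∧ (p ∧ q) (r ∧ t))))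
    (arith ⟦ p ∧ q ⟧ ⟦ r ∧ t ⟧ u v)
    where
    swap : ∀ p q r t → (p ∧ r) ∧ (q ∧ t) ≡ (p ∧ q) ∧ (r ∧ t)
    swap false q r t = refl
    swap true false false t = refl
    swap true false true t = refl
    swap true true r t = refl
    arith : ∀ a b u v → a * b * (u * v) ≡ a * u * (b * v)
    arith = solve-∀

∑-upTo-≡ᵇ : ∀ x m → x < m → ∑ (upTo m) (λ i → ⟦ i ≡ᵇ x ⟧) ≡ 1
∑-upTo-≡ᵇ zero (suc m) _ = trans (∑-upTo-suc m (λ i → ⟦ i ≡ᵇ 0 ⟧)) (cong suc (∑-zero (upTo m)))
∑-upTo-≡ᵇ (suc x) (suc m) (s≤s x<m) = trans (∑-upTo-suc m (λ i → ⟦ i ≡ᵇ suc x ⟧)) (∑-upTo-≡ᵇ x m x<m)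

points-once : ∀ {d} (n x : Vec ℕ d) → leqᵥ (𝟏 d) x ≡ true → leqᵥ x n ≡ true →
  multiplicity x (points n) ≡ 1
points-once V.[] V.[] _ _ = refl
points-once (m V.∷ n) (zero V.∷ xs) () x≤n
points-once (m V.∷ n) (suc ξ V.∷ xs) 1≤x x≤n = begin
  ∑ (points (m V.∷ n)) (λ p → ⟦ eqᵥ p (suc ξ V.∷ xs) ⟧)
    ≡⟨ ∑-points m n (λ p → ⟦ eqᵥ p (suc ξ V.∷ xs) ⟧) ⟩
  ∑ (upTo m) (λ i → ∑ (points n) (λ p → ⟦ (i ≡ᵇ ξ) ∧ eqᵥ p xs ⟧))
    ≡⟨ ∑-cong (upTo m) (λ i → trans (∑-cong (points n) (λ p → ⟦⟧-∧ (i ≡ᵇ ξ) _))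
                                    (∑-*ˡ (points n) ⟦ i ≡ᵇ ξ ⟧ _)) ⟩
  ∑ (upTo m) (λ i → ⟦ i ≡ᵇ ξ ⟧ * multiplicity xs (points n))
    ≡⟨ ∑-*ʳ (upTo m) (multiplicity xs (points n)) _ ⟩
  ∑ (upTo m) (λ i → ⟦ i ≡ᵇ ξ ⟧) * multiplicity xs (points n)
    ≡⟨ cong₂ _*_ (∑-upTo-≡ᵇ ξ m (true-≤ᵇ {suc ξ} {m} (∧-trueˡ x≤n)))
         (points-once n xs (∧-trueʳ {1 ≤ᵇ suc ξ} 1≤x) (∧-trueʳ {suc ξ ≤ᵇ m} x≤n)) ⟩
  1 ∎

points-bounds : ∀ {d} (n : Vec ℕ d) → All (λ q → leqᵥ (𝟏 d) q ≡ true × leqᵥ q n ≡ true) (points n)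
points-bounds V.[] = (refl , refl) ∷ []
points-bounds (m V.∷ n) = All.concat⁺ (All.map⁺ (All.map⁺ (All.applyUpTo⁺₁ id m (λ {i} i<m →
  All.map⁺ (All.map (λ (l , u) → l , cong₂ _∧_ (≤ᵇ-true i<m) u) (points-bounds n))))))

-- The enumeration is lexicographic, and the lexicographic order extends the product order.
points-sorted : ∀ {d} (n : Vec ℕ d) → Sorted (points n)
points-sorted V.[] = [] ∷ []
points-sorted (m V.∷ n) = AllPairs.concat⁺
  (All.map⁺ (All.universal (λ a → AllPairs.map⁺ (same a (points-sorted n))) (range1 m)))
  (AllPairs.map⁺ (AllPairs.map⁺ (AllPairs.applyUpTo⁺₁ id m (λ {i} {j} i<j _ →
    All.map⁺ (All.universal (λ p → All.map⁺ (All.universal (λ q →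
      cong (_∧ leqᵥ q p) (≤ᵇ-false {suc j} {suc i} (s<s i<j))) (points n))) (points n))))))
  where
  same : ∀ {d} a {ps : List (Vec ℕ d)} → Sorted ps →
    AllPairs (λ p q → leqᵥ (a V.∷ q) (a V.∷ p) ≡ false) ps
  same a [] = []
  same a (e ∷ es) = All.map (λ f → trans (cong ((a ≤ᵇ a) ∧_) f) (∧-zeroʳ (a ≤ᵇ a))) e ∷ same a es

-- Induction on the length with `a` varying: once the least point `p` is removed, the rest is a
-- multichain in the smaller interval [p, b].
W-interval : ∀ {d} (n b : Vec ℕ d) → leqᵥ b n ≡ true → ∀ s a →
  leqᵥ (𝟏 d) a ≡ true → leqᵥ a b ≡ true → W (between a b) (points n) s ≡ H₊ (b -ᵥ a) s
W-interval n b b≤n zero a 1≤a a≤b = trans (W-0 (between a b) (points n)) (sym (H₊-0 (b -ᵥ a)))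
W-interval {d} n b b≤n (suc s) a 1≤a a≤b = begin
  W (between a b) (points n) (suc s)
    ≡⟨ W-suc (between a b) (points n) (points-sorted n) s ⟩
  ∑ (points n) (λ p → ⟦ between a b p ⟧ * W (λ q → between a b q ∧ leqᵥ p q) (points n) s)
    ≡⟨ ∑-cong (points n) (λ p → step p (between a b p) refl) ⟩
  ∑ (points n) (λ p → ⟦ between a b p ⟧ * H₊ (b -ᵥ p) s)
    ≡⟨ ∑-interval n a b s 1≤a a≤b b≤n ⟩
  H₊ (b -ᵥ a) (suc s) ∎
  where
  raise : ∀ x y z → (z ≡ true → x ≡ true) → (x ∧ y) ∧ z ≡ z ∧ y
  raise x y false f = ∧-zeroʳ (x ∧ y)
  raise x y true f rewrite f refl = ∧-identityʳ y
  step : ∀ p c → between a b p ≡ c →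
    ⟦ c ⟧ * W (λ q → between a b q ∧ leqᵥ p q) (points n) s ≡ ⟦ c ⟧ * H₊ (b -ᵥ p) s
  step p false _ = refl
  step p true e = cong (1 *_) (trans
    (W-cong (points n) (λ q → raise (leqᵥ a q) (leqᵥ q b) (leqᵥ p q) (leq-trans a p q (∧-trueˡ e))) s)
    (W-interval n b b≤n s p (leq-trans (𝟏 d) a p 1≤a (∧-trueˡ e)) (∧-trueʳ {leqᵥ a p} e)))

-- All points lie in [1, n], so the two sides of the cut are the intervals [1, x] and [x, n].
Σ¹-conv : ∀ {d} (n x : Vec ℕ d) s → leqᵥ (𝟏 d) x ≡ true → leqᵥ x n ≡ true →
  Σ¹ n (suc s) x ≡ conv (H₊ (x -ᵥ 𝟏 d)) (H₊ (n -ᵥ x)) s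
Σ¹-conv {d} n x s 1≤x x≤n = begin
  Σ¹ n (suc s) x
    ≡⟨ Σ¹-W x n (suc s) once ⟩
  sg (W (comp x) (points n)) (suc s)
    ≡⟨ sg-W-comp x (points n) once s ⟩
  conv (W (λ q → leqᵥ q x) (points n)) (W (leqᵥ x) (points n)) s
    ≡⟨ conv-cong
         (λ i → trans (W-congᴬ (points n) (All.map (λ {q} (l , _) → cong (_∧ leqᵥ q x) (sym l)) (points-bounds n)) i)
                      (W-interval n x x≤n i (𝟏 d) (leq-refl (𝟏 d)) 1≤x))
         (λ i → trans (W-congᴬ (points n) (All.map (λ {q} (_ , u) →
                        trans (sym (∧-identityʳ (leqᵥ x q))) (cong (leqᵥ x q ∧_) (sym u))) (points-bounds n)) i)
                      (W-interval n n (leq-refl n) i x 1≤x x≤n)) s ⟩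
  conv (H₊ (x -ᵥ 𝟏 d)) (H₊ (n -ᵥ x)) s ∎
  where once = points-once n x 1≤x x≤n

-- Words and MacMahon's identity

prod : ℕ → (ℕ → ℕ) → ℕ
prod zero f = 1
prod (suc d) f = f 0 * prod d (f ∘ suc)

prod-cong : ∀ d {f g} → (∀ i → i < d → f i ≡ g i) → prod d f ≡ prod d g
prod-cong zero e = refl
prod-cong (suc d) e = cong₂ _*_ (e 0 z<s) (prod-cong d (λ i i<d → e (suc i) (s<s i<d)))

prod-one : ∀ d {f} → (∀ i → i < d → f i ≡ 1) → prod d f ≡ 1
prod-one zero e = refl
prod-one (suc d) e = cong₂ _*_ (e 0 z<s) (prod-one d (λ i i<d → e (suc i) (s<s i<d)))

prod-zero : ∀ d b {f} → b < d → f b ≡ 0 → prod d f ≡ 0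
prod-zero (suc d) zero {f} b<d e = cong (_* prod d (f ∘ suc)) e
prod-zero (suc d) (suc b) {f} (s≤s b<d) e = trans (cong (f 0 *_) (prod-zero d b b<d e)) (*-zeroʳ (f 0))

prod-split : ∀ d b {f g h} → b < d → (∀ i → i ≢ b → f i ≡ g i) → (∀ i → i ≢ b → f i ≡ h i) →
  f b ≡ g b + h b → prod d f ≡ prod d g + prod d h
prod-split (suc d) zero {f} {g} {h} b<d fg fh e = begin
  f 0 * prod d (f ∘ suc)                                    ≡⟨ cong (_* prod d (f ∘ suc)) e ⟩
  (g 0 + h 0) * prod d (f ∘ suc)                            ≡⟨ *-distribʳ-+ _ (g 0) (h 0) ⟩
  g 0 * prod d (f ∘ suc) + h 0 * prod d (f ∘ suc)
    ≡⟨ cong₂ (λ u v → g 0 * u + h 0 * v) (prod-cong d (λ i _ → fg (suc i) λ ()))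
                                         (prod-cong d (λ i _ → fh (suc i) λ ())) ⟩
  g 0 * prod d (g ∘ suc) + h 0 * prod d (h ∘ suc)           ∎
prod-split (suc d) (suc b) {f} {g} {h} (s≤s b<d) fg fh e = begin
  f 0 * prod d (f ∘ suc)
    ≡⟨ cong (f 0 *_) (prod-split d b b<d (λ i i≢b → fg (suc i) (i≢b ∘ suc-injective))
                                         (λ i i≢b → fh (suc i) (i≢b ∘ suc-injective)) e) ⟩
  f 0 * (prod d (g ∘ suc) + prod d (h ∘ suc))
    ≡⟨ *-distribˡ-+ (f 0) _ _ ⟩
  f 0 * prod d (g ∘ suc) + f 0 * prod d (h ∘ suc)
    ≡⟨ cong₂ (λ u v → u * prod d (g ∘ suc) + v * prod d (h ∘ suc)) (fg 0 λ ()) (fh 0 λ ()) ⟩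
  g 0 * prod d (g ∘ suc) + h 0 * prod d (h ∘ suc) ∎

-- The number of multisets of size q on k types. `H m` already has m + 1 types, so k = 0 is a case
-- of its own.
multichoose : ℕ → ℕ → ℕ
multichoose zero zero = 1
multichoose zero (suc q) = 0
multichoose (suc m) q = H m q

multichoose-0 : ∀ k → multichoose k 0 ≡ 1
multichoose-0 zero = refl
multichoose-0 (suc m) = H-0 m

multichoose-suc : ∀ k q → multichoose (suc k) (suc q) ≡ multichoose k (suc q) + multichoose (suc k) q
multichoose-suc zero q = refl
multichoose-suc (suc m) q = +-comm (H (suc m) q) (H m (suc q))

≡ᵇ-false : ∀ {m n} → m ≢ n → (m ≡ᵇ n) ≡ false
≡ᵇ-false {m} {n} m≢n with m ≡ᵇ n in eq
... | false = refl
... | true = ⊥-elim (m≢n (true-≡ᵇ eq))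

dec : ℕ → (ℕ → ℕ) → ℕ → ℕ
dec b p i = if b ≡ᵇ i then p i ∸ 1 else p i

dec-≢ : ∀ b p {i} → i ≢ b → dec b p i ≡ p i
dec-≢ b p {i} i≢b = cong (λ c → if c then p i ∸ 1 else p i) (≡ᵇ-false (i≢b ∘ sym))

dec-≡ : ∀ b p → dec b p b ≡ p b ∸ 1
dec-≡ b p = cong (λ c → if c then p b ∸ 1 else p b) (≡ᵇ-refl b)

∑-dec : ∀ d b p → b < d → 0 < p b → ∑ (upTo d) p ≡ suc (∑ (upTo d) (dec b p))
∑-dec (suc d) zero p b<d 0<p = begin
  ∑ (upTo (suc d)) p                        ≡⟨ ∑-upTo-suc d p ⟩
  p 0 + ∑ (upTo d) (p ∘ suc)                ≡⟨ cong (_+ ∑ (upTo d) (p ∘ suc)) (m+[n∸m]≡n 0<p) ⟨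
  suc (p 0 ∸ 1 + ∑ (upTo d) (p ∘ suc))      ≡⟨ cong suc (∑-upTo-suc d (dec 0 p)) ⟨
  suc (∑ (upTo (suc d)) (dec 0 p))          ∎
∑-dec (suc d) (suc b) p (s≤s b<d) 0<p = begin
  ∑ (upTo (suc d)) p                                  ≡⟨ ∑-upTo-suc d p ⟩
  p 0 + ∑ (upTo d) (p ∘ suc)                          ≡⟨ cong (p 0 +_) (∑-dec d b (p ∘ suc) b<d 0<p) ⟩
  p 0 + suc (∑ (upTo d) (dec b (p ∘ suc)))            ≡⟨ +-suc (p 0) _ ⟩
  suc (p 0 + ∑ (upTo d) (dec b (p ∘ suc)))            ≡⟨ cong suc (∑-upTo-suc d (dec (suc b) p)) ⟨
  suc (∑ (upTo (suc d)) (dec (suc b) p))              ∎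

-- R d a k p counts the sequences weakly increasing for the lexicographic
-- order on levels × letters that have letter content p, use at most k
-- levels and start at or after letter a of the first level (letters are
-- indexed from 0 here): these are multisets of pairs.

slots : ℕ → ℕ → ℕ → ℕ
slots a m i = if a ≤ᵇ i then suc m else m

R : ℕ → ℕ → ℕ → (ℕ → ℕ) → ℕ
R d a zero p = 0
R d a (suc m) p = prod d (λ i → multichoose (slots a m i) (p i))

≤ᵇ-suc : ∀ {b i} → i ≢ b → (b ≤ᵇ i) ≡ (suc b ≤ᵇ i)
≤ᵇ-suc {b} {i} i≢b with <-cmp b i
... | tri< b<i _ _ = trans (≤ᵇ-true (<⇒≤ b<i)) (sym (≤ᵇ-true b<i))
... | tri≈ _ b≡i _ = ⊥-elim (i≢b (sym b≡i))
... | tri> _ _ i<b = trans (≤ᵇ-false i<b) (sym (≤ᵇ-false (m<n⇒m<1+n i<b)))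

-- Either the pair (first level, `b`) is absent and the start moves on to the next letter, or one
-- copy of it is removed. In the product this is Pascal's rule in the factor of `b`.
R-step : ∀ d b k p → b < d → R d b k p ≡ R d (suc b) k p + ⟦ 0 <ᵇ p b ⟧ * R d b k (dec b p)
R-step d b zero p b<d = sym (*-zeroʳ ⟦ 0 <ᵇ p b ⟧)
R-step d b (suc m) p b<d with p b in pb
... | zero = trans (prod-cong d factor) (sym (+-identityʳ _))
  where
  factor : ∀ i → i < d → multichoose (slots b m i) (p i) ≡ multichoose (slots (suc b) m i) (p i)
  factor i _ with i ≟ b
  ... | yes refl rewrite pb = trans (multichoose-0 (slots i m i)) (sym (multichoose-0 (slots (suc i) m i)))
  ... | no i≢b = cong (λ c → multichoose (if c then suc m else m) (p i)) (≤ᵇ-suc i≢b)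
... | suc q = trans
  (prod-split d b b<d
    (λ i i≢b → cong (λ c → multichoose (if c then suc m else m) (p i)) (≤ᵇ-suc i≢b))
    (λ i i≢b → cong (multichoose (slots b m i)) (sym (dec-≢ b p i≢b)))
    at-b)
  (cong (R d (suc b) (suc m) p +_) (sym (*-identityˡ _)))
  where
  at-b : multichoose (slots b m b) (p b) ≡
         multichoose (slots (suc b) m b) (p b) + multichoose (slots b m b) (dec b p b)
  at-b rewrite dec-≡ b p | pb | ≤ᵇ-true (≤-refl {b}) | ≤ᵇ-false (n<1+n b) = multichoose-suc m q

-- After the last letter of a level comes the first letter of the next one.
R-wrap : ∀ d k p → ∑ (upTo d) p ≢ 0 → R d d (suc k) p ≡ R d 0 k p
R-wrap d (suc m) p _ = prod-cong d (λ i i<d →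
  cong (λ c → multichoose (if c then 2 + m else suc m) (p i)) (≤ᵇ-false i<d))
-- Without levels `R` is 0 by definition, whereas the product over empty slots is 1 for empty
-- content; nonempty content makes the two agree.
R-wrap d zero p ∑≢0 = trans
  (prod-cong d (λ i i<d → cong (λ c → multichoose (if c then 1 else 0) (p i)) (≤ᵇ-false i<d)))
  (vanish d p ∑≢0)
  where
  vanish : ∀ d p → ∑ (upTo d) p ≢ 0 → prod d (λ i → multichoose 0 (p i)) ≡ 0
  vanish zero p ne = ⊥-elim (ne refl)
  vanish (suc d) p ne = go (p 0) refl
    where
    go : ∀ q → p 0 ≡ q → multichoose 0 q * prod d (λ i → multichoose 0 (p (suc i))) ≡ 0
    go zero p0 = trans (+-identityʳ _)
      (vanish d (p ∘ suc) λ e → ne (trans (∑-upTo-suc d p) (cong₂ _+_ p0 e)))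
    go (suc _) p0 = refl

telescope : ∀ d (v v′ : ℕ → ℕ) → (∀ b → b < d → v b ≡ v (suc b) + v′ b) → ∑ (upTo d) v′ + v d ≡ v 0
telescope zero v v′ step = refl
telescope (suc d) v v′ step = begin
  ∑ (upTo (suc d)) v′ + v (suc d)               ≡⟨ cong (_+ v (suc d)) (∑-upTo-suc d v′) ⟩
  v′ 0 + ∑ (upTo d) (v′ ∘ suc) + v (suc d)      ≡⟨ +-assoc (v′ 0) _ _ ⟩
  v′ 0 + (∑ (upTo d) (v′ ∘ suc) + v (suc d))
    ≡⟨ cong (v′ 0 +_) (telescope d (v ∘ suc) (v′ ∘ suc) (λ b b<d → step (suc b) (s<s b<d))) ⟩
  v′ 0 + v 1                                    ≡⟨ +-comm (v′ 0) (v 1) ⟩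
  v 1 + v′ 0                                    ≡⟨ step 0 z<s ⟨
  v 0                                           ∎

-- The sum is (u 0 - u a) + (v a - v d), written without subtraction. It serves for first letters
-- `b` < `a`, which make a descent, and `b` ≥ `a`, which do not.
telescope₂ : ∀ d a (u v u′ v′ : ℕ → ℕ) → a ≤ d →
  (∀ b → b < d → u b ≡ u (suc b) + u′ b) → (∀ b → b < d → v b ≡ v (suc b) + v′ b) →
  ∑ (upTo d) (λ b → if b <ᵇ a then u′ b else v′ b) + u a + v d ≡ u 0 + v a
telescope₂ d zero u v u′ v′ a≤d su sv = begin
  ∑ (upTo d) v′ + u 0 + v d    ≡⟨ swap (∑ (upTo d) v′) (u 0) (v d) ⟩
  u 0 + (∑ (upTo d) v′ + v d)  ≡⟨ cong (u 0 +_) (telescope d v v′ sv) ⟩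
  u 0 + v 0                    ∎
  where
  swap : ∀ a b c → a + b + c ≡ b + (a + c)
  swap = solve-∀
telescope₂ (suc d) (suc a) u v u′ v′ (s≤s a≤d) su sv = begin
  ∑ (upTo (suc d)) f + u (suc a) + v (suc d)
    ≡⟨ cong (λ k → k + u (suc a) + v (suc d)) (∑-upTo-suc d f) ⟩
  u′ 0 + ∑ (upTo d) (f ∘ suc) + u (suc a) + v (suc d)
    ≡⟨ assoc (u′ 0) (∑ (upTo d) (f ∘ suc)) (u (suc a)) (v (suc d)) ⟩
  u′ 0 + (∑ (upTo d) (f ∘ suc) + u (suc a) + v (suc d))
    ≡⟨ cong (u′ 0 +_) (telescope₂ d a (u ∘ suc) (v ∘ suc) (u′ ∘ suc) (v′ ∘ suc) a≤d
         (λ b b<d → su (suc b) (s<s b<d)) (λ b b<d → sv (suc b) (s<s b<d))) ⟩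
  u′ 0 + (u 1 + v (suc a))
    ≡⟨ swap (u′ 0) (u 1) (v (suc a)) ⟩
  u 1 + u′ 0 + v (suc a)
    ≡⟨ cong (_+ v (suc a)) (su 0 z<s) ⟨
  u 0 + v (suc a) ∎
  where
  f : ℕ → ℕ
  f = λ b → if b <ᵇ suc a then u′ b else v′ b
  assoc : ∀ a b c d → a + b + c + d ≡ a + (b + c + d)
  assoc = solve-∀
  swap : ∀ a b c → a + (b + c) ≡ b + a + c
  swap = solve-∀

-- Q D L m is the coefficient of t^m in t^D / (1 − t)^(L + 1).
Q : ℕ → ℕ → ℕ → ℕ
Q zero L m = H L m
Q (suc D) L zero = 0
Q (suc D) L (suc m) = Q D L m

Q-suc-0 : ∀ D L → Q D (suc L) 0 ≡ Q D L 0
Q-suc-0 zero L = sym (H-0 L)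
Q-suc-0 (suc D) L = refl

Q-suc : ∀ D L m → Q D (suc L) (suc m) ≡ Q D (suc L) m + Q D L (suc m)
Q-suc zero L m = refl
Q-suc (suc D) L zero = Q-suc-0 D L
Q-suc (suc D) L (suc m) = Q-suc D L m

conv-monomial : ∀ D L m → conv (λ k → ⟦ D ≡ᵇ k ⟧) (H L) m ≡ Q D L m
conv-monomial zero L m = trans (conv-cong {g = H L} δ≗ (λ _ → refl) m) (conv-δˡ (H L) m)
  where
  δ≗ : (λ k → ⟦ 0 ≡ᵇ k ⟧) ≗ δ
  δ≗ zero = refl
  δ≗ (suc k) = refl
conv-monomial (suc D) L zero = refl
conv-monomial (suc D) L (suc m) = conv-monomial D L m

des-∷ : ∀ a b w → des (a ∷ b ∷ w) ≡ ⟦ b <ᵇ a ⟧ + des (b ∷ w)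
des-∷ a b w with b <ᵇ a
... | true = refl
... | false = refl

count-∷ : ∀ j b w → count j (b ∷ w) ≡ ⟦ b ≡ᵇ j ⟧ + count j w
count-∷ j b w with b ≡ᵇ j
... | true = refl
... | false = refl

-- An indicator with values in ℕ, so that it can serve as a weight. The letters of words start at 1,
-- the content function at 0.
hasContent : ℕ → (ℕ → ℕ) → List ℕ → ℕ
hasContent d p w = prod d (λ i → ⟦ count (suc i) w ≡ᵇ p i ⟧)

hasContent-∷ : ∀ d b p w → b < d →
  hasContent d p (suc b ∷ w) ≡ ⟦ 0 <ᵇ p b ⟧ * hasContent d (dec b p) w
hasContent-∷ d b p w b<d with p b in pb
... | zero = prod-zero d b b<d at-b
  where
  at-b : ⟦ count (suc b) (suc b ∷ w) ≡ᵇ p b ⟧ ≡ 0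
  at-b rewrite count-∷ (suc b) (suc b) w | ≡ᵇ-refl b | pb = refl
... | suc q = trans (prod-cong d factor) (sym (*-identityˡ _))
  where
  factor : ∀ i → i < d → ⟦ count (suc i) (suc b ∷ w) ≡ᵇ p i ⟧ ≡ ⟦ count (suc i) w ≡ᵇ dec b p i ⟧
  factor i _ with i ≟ b
  ... | yes refl rewrite count-∷ (suc b) (suc b) w | ≡ᵇ-refl b | pb = refl
  ... | no i≢b rewrite count-∷ (suc i) (suc b) w | ≡ᵇ-false (i≢b ∘ sym) = refl

∑-allWords : ∀ d L f →
  ∑ (allWords d (suc L)) f ≡ ∑ (upTo d) (λ b → ∑ (allWords d L) (λ w → f (suc b ∷ w)))
∑-allWords d L f = begin
  ∑ (allWords d (suc L)) f
    ≡⟨ ∑-concatMap (λ a → map (a ∷_) (allWords d L)) (range1 d) f ⟩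
  ∑ (range1 d) (λ a → ∑ (map (a ∷_) (allWords d L)) f)
    ≡⟨ ∑-map suc (upTo d) _ ⟩
  ∑ (upTo d) (λ b → ∑ (map (suc b ∷_) (allWords d L)) f)
    ≡⟨ ∑-cong (upTo d) (λ b → ∑-map (suc b ∷_) (allWords d L) f) ⟩
  ∑ (upTo d) (λ b → ∑ (allWords d L) (λ w → f (suc b ∷ w))) ∎

-- Q (des (suc a ∷ w)) L m counts the ways of assigning levels 0, …, m to the
-- letters of w, weakly increasing and strictly increasing at each descent.
barredWords : ℕ → ℕ → ℕ → ℕ → (ℕ → ℕ) → ℕ
barredWords d L a m p = ∑ (allWords d L) (λ w → hasContent d p w * Q (des (suc a ∷ w)) L m)

-- The barred words whose first letter lies on the first level.
firstLevel : ℕ → ℕ → ℕ → ℕ → (ℕ → ℕ) → ℕ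
firstLevel d L a m p = ∑ (allWords d (suc L)) (λ w → hasContent d p w * Q (des (suc a ∷ w)) L m)

sum-zero : ∀ d p → ∑ (upTo d) p ≡ 0 → ∀ i → i < d → p i ≡ 0
sum-zero (suc d) p e zero _ = m+n≡0⇒m≡0 (p 0) (trans (sym (∑-upTo-suc d p)) e)
sum-zero (suc d) p e (suc i) (s≤s i<d) =
  sum-zero d (p ∘ suc) (m+n≡0⇒n≡0 (p 0) (trans (sym (∑-upTo-suc d p)) e)) i i<d

mutual

  barredWords-R : ∀ d L a m p → a ≤ d → ∑ (upTo d) p ≡ L → barredWords d L a m p ≡ R d a (suc m) p
  barredWords-R d zero a m p a≤d ∑p = trans (+-identityʳ _) (trans (*-identityʳ _) (trans
    (prod-one d (λ i i<d → cong (λ k → ⟦ 0 ≡ᵇ k ⟧) (p≡0 i i<d)))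
    (sym (prod-one d (λ i i<d → trans (cong (multichoose (slots a m i)) (p≡0 i i<d))
                                      (multichoose-0 (slots a m i)))))))
    where p≡0 = sum-zero d p ∑p
  barredWords-R d (suc L) a zero p a≤d ∑p = begin
    barredWords d (suc L) a 0 p
      ≡⟨ ∑-cong (allWords d (suc L)) (λ w → cong (hasContent d p w *_) (Q-suc-0 (des (suc a ∷ w)) L)) ⟩
    firstLevel d L a 0 p
      ≡⟨ +-identityʳ _ ⟨
    firstLevel d L a 0 p + R d a 0 p
      ≡⟨ firstLevel-R d L a 0 p a≤d ∑p ⟩
    R d a 1 p ∎
  barredWords-R d (suc L) a (suc m) p a≤d ∑p = begin
    barredWords d (suc L) a (suc m) p
      ≡⟨ ∑-cong (allWords d (suc L)) (λ w → trans
           (cong (hasContent d p w *_) (Q-suc (des (suc a ∷ w)) L m))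
           (*-distribˡ-+ (hasContent d p w) _ _)) ⟩
    ∑ (allWords d (suc L)) (λ w → hasContent d p w * Q (des (suc a ∷ w)) (suc L) m
                                + hasContent d p w * Q (des (suc a ∷ w)) L (suc m))
      ≡⟨ ∑-+ (allWords d (suc L)) _ _ ⟩
    barredWords d (suc L) a m p + firstLevel d L a (suc m) p
      ≡⟨ cong (_+ firstLevel d L a (suc m) p) (barredWords-R d (suc L) a m p a≤d ∑p) ⟩
    R d a (suc m) p + firstLevel d L a (suc m) p
      ≡⟨ +-comm (R d a (suc m) p) _ ⟩
    firstLevel d L a (suc m) p + R d a (suc m) p
      ≡⟨ firstLevel-R d L a (suc m) p a≤d ∑p ⟩
    R d a (2 + m) p ∎

  -- A first letter `b` ≥ `a` stays on the level of `a`, and `b` < `a` is pushed to the next one.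
  -- Together these run through the pairs from letter `a` of the first level up to, but excluding,
  -- letter `a` of the second; the sequences that start later are counted by `R d a m p`.
  firstLevel-R : ∀ d L a m p → a ≤ d → ∑ (upTo d) p ≡ suc L →
    firstLevel d L a m p + R d a m p ≡ R d a (suc m) p
  -- Telescoping leaves `R d d (suc m) p` on the left and `R d 0 m p` on the right; `R-wrap`
  -- identifies them and they cancel.
  firstLevel-R d L a m p a≤d ∑p = +-cancelʳ-≡ (R d d (suc m) p) _ _ (begin
    firstLevel d L a m p + R d a m p + R d d (suc m) p
      ≡⟨ cong (λ k → k + R d a m p + R d d (suc m) p) (trans
           (∑-allWords d L (λ w → hasContent d p w * Q (des (suc a ∷ w)) L m))
           (∑-upTo-cong d (λ b b<d → trans (factor b b<d) (byLetter b b<d (p b) refl (b <ᵇ a))))) ⟩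
    ∑ (upTo d) (λ b → if b <ᵇ a then step m b else step (suc m) b) + R d a m p + R d d (suc m) p
      ≡⟨ telescope₂ d a (λ b → R d b m p) (λ b → R d b (suc m) p) (step m) (step (suc m)) a≤d
           (λ b → R-step d b m p) (λ b → R-step d b (suc m) p) ⟩
    R d 0 m p + R d a (suc m) p
      ≡⟨ +-comm (R d 0 m p) _ ⟩
    R d a (suc m) p + R d 0 m p
      ≡⟨ cong (R d a (suc m) p +_) (R-wrap d m p (λ e → 0≢1+n (trans (sym e) ∑p))) ⟨
    R d a (suc m) p + R d d (suc m) p ∎)
    where
    step : ℕ → ℕ → ℕ
    step k b = ⟦ 0 <ᵇ p b ⟧ * R d b k (dec b p)
    factor : ∀ b → b < d →
      ∑ (allWords d L) (λ w → hasContent d p (suc b ∷ w) * Q (des (suc a ∷ suc b ∷ w)) L m) ≡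
      ⟦ 0 <ᵇ p b ⟧ * ∑ (allWords d L) (λ w → hasContent d (dec b p) w * Q (⟦ b <ᵇ a ⟧ + des (suc b ∷ w)) L m)
    factor b b<d = trans
      (∑-cong (allWords d L) (λ w → trans
        (cong₂ (λ h D → h * Q D L m) (hasContent-∷ d b p w b<d) (des-∷ (suc a) (suc b) w))
        (*-assoc ⟦ 0 <ᵇ p b ⟧ _ _)))
      (∑-*ˡ (allWords d L) ⟦ 0 <ᵇ p b ⟧ _)
    -- A descent uses up a level: with m = 0 both sides vanish, otherwise one level fewer remains
    -- for the shorter words.
    below : ∀ b → b < d → 0 < p b → ∀ m →
      ∑ (allWords d L) (λ w → hasContent d (dec b p) w * Q (suc (des (suc b ∷ w))) L m) ≡ R d b m (dec b p)
    below b b<d 0<p zero = trans (∑-cong (allWords d L) (λ w → *-zeroʳ (hasContent d (dec b p) w)))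
                                 (∑-zero (allWords d L))
    below b b<d 0<p (suc m) = barredWords-R d L b m (dec b p) (<⇒≤ b<d)
      (suc-injective (trans (sym (∑-dec d b p b<d 0<p)) ∑p))
    byLetter : ∀ b → b < d → ∀ q → p b ≡ q → ∀ c →
      ⟦ 0 <ᵇ p b ⟧ * ∑ (allWords d L) (λ w → hasContent d (dec b p) w * Q (⟦ c ⟧ + des (suc b ∷ w)) L m) ≡
      (if c then step m b else step (suc m) b)
    byLetter b b<d zero pb true rewrite pb = refl
    byLetter b b<d zero pb false rewrite pb = refl
    byLetter b b<d (suc q) pb true =
      cong (⟦ 0 <ᵇ p b ⟧ *_) (below b b<d (subst (0 <_) (sym pb) z<s) m)
    byLetter b b<d (suc q) pb false =
      cong (⟦ 0 <ᵇ p b ⟧ *_) (below b b<d (subst (0 <_) (sym pb) z<s) (suc m))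

at : ∀ {d} → Vec ℕ d → ℕ → ℕ
at V.[] _ = 0
at (q V.∷ p) zero = q
at (q V.∷ p) (suc i) = at p i

∑-at : ∀ {d} (p : Vec ℕ d) → ∑ (upTo d) (at p) ≡ ∣ p ∣ᵥ
∑-at V.[] = refl
∑-at {suc d} (q V.∷ p) = trans (∑-upTo-suc d (at (q V.∷ p))) (cong (q +_) (∑-at p))

prod-at : ∀ {d} (p : Vec ℕ d) m → prod d (λ i → H m (at p i)) ≡ H₊ p m
prod-at V.[] m = refl
prod-at (q V.∷ p) m = cong₂ _*_ (H-sym m q) (prod-at p m)

content-prod : ∀ {d} (c f : ℕ → ℕ) (p : Vec ℕ d) →
  ⟦ and (zipWith (λ i q → c i ≡ᵇ q) (applyUpTo f d) (V.toList p)) ⟧ ≡ prod d (λ i → ⟦ c (f i) ≡ᵇ at p i ⟧)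
content-prod c f V.[] = refl
content-prod c f (q V.∷ p) = trans (⟦⟧-∧ (c (f 0) ≡ᵇ q) _)
  (cong (⟦ c (f 0) ≡ᵇ q ⟧ *_) (content-prod c (f ∘ suc) p))

∑-multisetWords : ∀ {d} (p : Vec ℕ d) f →
  ∑ (multisetWords p) f ≡ ∑ (allWords d ∣ p ∣ᵥ) (λ w → hasContent d (at p) w * f w)
∑-multisetWords {d} p f = trans (∑-filterᵇ _ (allWords d ∣ p ∣ᵥ) f)
  (∑-cong (allWords d ∣ p ∣ᵥ) (λ w → cong (_* f w) (trans
    (cong (λ l → ⟦ and (zipWith (λ i q → count i w ≡ᵇ q) l (V.toList p)) ⟧) (map-upTo suc d))
    (content-prod (λ i → count i w) suc p))))

eulerCoeff-∑ : ∀ {d} (p : Vec ℕ d) k → eulerCoeff p k ≡ ∑ (multisetWords p) (λ w → ⟦ des w ≡ᵇ k ⟧)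
eulerCoeff-∑ p k = length-filterᵇ (λ w → des w ≡ᵇ k) (multisetWords p)

-- A smallest letter in front creates no descent. This supplies the previous letter that
-- `barredWords` expects, with `a` = 0.
des-1∷ : ∀ d L (f : List ℕ → ℕ → ℕ) →
  ∑ (allWords d L) (λ w → f w (des w)) ≡ ∑ (allWords d L) (λ w → f w (des (1 ∷ w)))
des-1∷ d zero f = refl
des-1∷ d (suc L) f = trans (∑-allWords d L (λ w → f w (des w)))
  (sym (∑-allWords d L (λ w → f w (des (1 ∷ w)))))

macMahon : ∀ {d} (p : Vec ℕ d) → conv (eulerCoeff p) (H ∣ p ∣ᵥ) ≗ H₊ p
macMahon {d} p m = begin
  conv (eulerCoeff p) (H L) m
    ≡⟨ conv-cong {g = H L} (eulerCoeff-∑ p) (λ _ → refl) m ⟩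
  conv (λ k → ∑ (multisetWords p) (λ w → ⟦ des w ≡ᵇ k ⟧)) (H L) m
    ≡⟨ conv-∑ˡ (multisetWords p) (λ w k → ⟦ des w ≡ᵇ k ⟧) (H L) m ⟩
  ∑ (multisetWords p) (λ w → conv (λ k → ⟦ des w ≡ᵇ k ⟧) (H L) m)
    ≡⟨ ∑-cong (multisetWords p) (λ w → conv-monomial (des w) L m) ⟩
  ∑ (multisetWords p) (λ w → Q (des w) L m)
    ≡⟨ ∑-multisetWords p _ ⟩
  ∑ (allWords d L) (λ w → hasContent d (at p) w * Q (des w) L m)
    ≡⟨ des-1∷ d L (λ w D → hasContent d (at p) w * Q D L m) ⟩
  barredWords d L 0 m (at p)
    ≡⟨ barredWords-R d L 0 m (at p) z≤n (∑-at p) ⟩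
  prod d (λ i → H m (at p i))
    ≡⟨ prod-at p m ⟩
  H₊ p m ∎
  where L = ∣ p ∣ᵥ

-- Degree of the multiset Eulerian polynomials

⟦⟧≤1 : ∀ b → ⟦ b ⟧ ≤ 1
⟦⟧≤1 true = ≤-refl
⟦⟧≤1 false = z≤n

<ᵇ-true : ∀ {m n} → m < n → (m <ᵇ n) ≡ true
<ᵇ-true m<n = ≤ᵇ-true m<n

<ᵇ-false : ∀ {m n} → n ≤ m → (m <ᵇ n) ≡ false
<ᵇ-false n≤m = ≤ᵇ-false (s≤s n≤m)

-- Between two occurrences of the letter j there is a position that is not
-- a descent.
des-count : ∀ j b w → ⟦ b <ᵇ j ⟧ + des (b ∷ w) + count j (b ∷ w) ≤ suc (length w)
des-count j b [] rewrite count-∷ j b [] with <-cmp b j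
... | tri< b<j b≢j _ rewrite <ᵇ-true b<j | ≡ᵇ-false b≢j = ≤-refl
... | tri≈ b≮j refl _ rewrite <ᵇ-false (≤-refl {b}) | ≡ᵇ-refl b = ≤-refl
... | tri> b≮j b≢j j<b rewrite <ᵇ-false (<⇒≤ j<b) | ≡ᵇ-false b≢j = z≤n
des-count j b (c ∷ w) rewrite count-∷ j b (c ∷ w) | des-∷ b c w =
  subst (_≤ 2 + length w) (sym (regroup ⟦ b <ᵇ j ⟧ ⟦ c <ᵇ b ⟧ D ⟦ b ≡ᵇ j ⟧ K))
    (≤-trans (+-monoˡ-≤ (D + K) local)
      (subst (_≤ 2 + length w) (sym (regroup′ ⟦ c <ᵇ j ⟧ D K)) (s≤s (des-count j c w))))
  where
  D = des (c ∷ w)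
  K = count j (c ∷ w)
  -- The indicator of `b` < `j` is a credit: from below `j`, the letter `j` is reached only through
  -- a non-descent. With the credit, each new letter raises the left side by at most one.
  local : ⟦ b <ᵇ j ⟧ + ⟦ c <ᵇ b ⟧ + ⟦ b ≡ᵇ j ⟧ ≤ suc ⟦ c <ᵇ j ⟧
  local with <-cmp b j | <-cmp c b
  ... | tri< b<j b≢j _ | tri< c<b _ _
    rewrite <ᵇ-true b<j | ≡ᵇ-false b≢j | <ᵇ-true c<b | <ᵇ-true (<-trans c<b b<j) = ≤-refl
  ... | tri< b<j b≢j _ | tri≈ _ refl _
    rewrite <ᵇ-true b<j | ≡ᵇ-false b≢j | <ᵇ-false (≤-refl {b}) = s≤s z≤n
  ... | tri< b<j b≢j _ | tri> _ _ b<c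
    rewrite <ᵇ-true b<j | ≡ᵇ-false b≢j | <ᵇ-false (<⇒≤ b<c) = s≤s z≤n
  ... | tri≈ _ refl _ | tri< c<b _ _
    rewrite <ᵇ-false (≤-refl {b}) | ≡ᵇ-refl b | <ᵇ-true c<b = ≤-refl
  ... | tri≈ _ refl _ | tri≈ _ refl _
    rewrite <ᵇ-false (≤-refl {b}) | ≡ᵇ-refl b = ≤-refl
  ... | tri≈ _ refl _ | tri> _ _ b<c
    rewrite <ᵇ-false (≤-refl {b}) | ≡ᵇ-refl b | <ᵇ-false (<⇒≤ b<c) = ≤-refl
  ... | tri> _ b≢j j<b | _
    rewrite <ᵇ-false (<⇒≤ j<b) | ≡ᵇ-false b≢j | +-identityʳ ⟦ c <ᵇ b ⟧ = ≤-trans (⟦⟧≤1 (c <ᵇ b)) (s≤s z≤n)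
  regroup : ∀ x y D z K → x + (y + D) + (z + K) ≡ x + y + z + (D + K)
  regroup = solve-∀
  regroup′ : ∀ x D K → suc x + (D + K) ≡ suc (x + D + K)
  regroup′ = solve-∀

des+count≤length : ∀ j w → des w + count j w ≤ length w
des+count≤length j [] = z≤n
des+count≤length j (b ∷ w) = ≤-trans
  (+-monoˡ-≤ (count j (b ∷ w)) (m≤n+m (des (b ∷ w)) ⟦ b <ᵇ j ⟧)) (des-count j b w)

allWords-length : ∀ d L → All (λ w → length w ≡ L) (allWords d L)
allWords-length d zero = refl ∷ []
allWords-length d (suc L) = All.concat⁺ (All.map⁺ (All.universal
  (λ a → All.map⁺ (All.map (cong suc) (allWords-length d L))) (range1 d)))

prod-⟦⟧ : ∀ d (b : ℕ → Bool) → prod d (λ i → ⟦ b i ⟧) ≡ 0 ⊎ (∀ i → i < d → b i ≡ true)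
prod-⟦⟧ zero b = inj₂ λ _ ()
prod-⟦⟧ (suc d) b with b 0 in b0 | prod-⟦⟧ d (b ∘ suc)
... | false | _ = inj₁ refl
... | true | inj₁ e = inj₁ (trans (+-identityʳ _) e)
... | true | inj₂ f = inj₂ λ { zero _ → b0 ; (suc i) (s≤s i<d) → f i i<d }

+-max-≤ : ∀ {d} (p : Vec ℕ d) D N → D ≤ N → (∀ i → i < d → D + at p i ≤ N) → D + maxᵥ p ≤ N
+-max-≤ V.[] D N D≤N _ = subst (_≤ N) (sym (+-identityʳ D)) D≤N
+-max-≤ (q V.∷ p) D N D≤N f = subst (_≤ N) (sym (+-distribˡ-⊔ D q (maxᵥ p)))
  (⊔-lub (f 0 z<s) (+-max-≤ p D N D≤N (λ i i<d → f (suc i) (s<s i<d))))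

eulerCoeff-degree : ∀ {d} (p : Vec ℕ d) k → ∣ p ∣ᵥ < k + maxᵥ p → eulerCoeff p k ≡ 0
eulerCoeff-degree {d} p k big = begin
  eulerCoeff p k
    ≡⟨ eulerCoeff-∑ p k ⟩
  ∑ (multisetWords p) (λ w → ⟦ des w ≡ᵇ k ⟧)
    ≡⟨ ∑-multisetWords p _ ⟩
  ∑ (allWords d ∣ p ∣ᵥ) (λ w → hasContent d (at p) w * ⟦ des w ≡ᵇ k ⟧)
    ≡⟨ ∑-congᴬ (All.map (λ {w} → vanish w) (allWords-length d ∣ p ∣ᵥ)) ⟩
  ∑ (allWords d ∣ p ∣ᵥ) (λ _ → 0)
    ≡⟨ ∑-zero (allWords d ∣ p ∣ᵥ) ⟩
  0 ∎
  where
  vanish : ∀ w → length w ≡ ∣ p ∣ᵥ → hasContent d (at p) w * ⟦ des w ≡ᵇ k ⟧ ≡ 0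
  vanish w len with des w ≡ᵇ k in dk | prod-⟦⟧ d (λ i → count (suc i) w ≡ᵇ at p i)
  ... | false | _ = *-zeroʳ (hasContent d (at p) w)
  ... | true | inj₁ e = cong (_* 1) e
  ... | true | inj₂ f with refl ← true-≡ᵇ {des w} {k} dk = ⊥-elim (<⇒≱ big
    (+-max-≤ p k ∣ p ∣ᵥ (subst (k ≤_) len (≤-trans (m≤m+n k _) (des+count≤length 0 w)))
      (λ i i<d → subst₂ (λ u v → k + u ≤ v) (true-≡ᵇ (f i i<d)) len (des+count≤length (suc i) w))))

-- Assembling the formula

lookup⇒leq : ∀ {d} (a b : Vec ℕ d) → (∀ i → lookup a i ≤ lookup b i) → leqᵥ a b ≡ true
lookup⇒leq V.[] V.[] _ = refl
lookup⇒leq (α V.∷ a) (β V.∷ b) h = cong₂ _∧_ (≤ᵇ-true (h zero)) (lookup⇒leq a b (h ∘ suc))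

lookup⇒𝟏≤ : ∀ {d} (a : Vec ℕ d) → (∀ i → 1 ≤ lookup a i) → leqᵥ (𝟏 d) a ≡ true
lookup⇒𝟏≤ V.[] _ = refl
lookup⇒𝟏≤ (α V.∷ a) h = cong₂ _∧_ (≤ᵇ-true (h zero)) (lookup⇒𝟏≤ a (h ∘ suc))

∣∣-split : ∀ {d} (n x : Vec ℕ d) → leqᵥ (𝟏 d) x ≡ true → leqᵥ x n ≡ true →
  ∣ x -ᵥ 𝟏 d ∣ᵥ + ∣ n -ᵥ x ∣ᵥ + d ≡ ∣ n ∣ᵥ
∣∣-split V.[] V.[] _ _ = refl
∣∣-split (m V.∷ n) (zero V.∷ x) () _
∣∣-split {suc d} (m V.∷ n) (suc ξ V.∷ x) 1≤x x≤n = begin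
  (ξ + X) + (m ∸ suc ξ + Y) + suc d        ≡⟨ regroup ξ X (m ∸ suc ξ) Y d ⟩
  (suc ξ + (m ∸ suc ξ)) + (X + Y + d)
    ≡⟨ cong₂ _+_ (m+[n∸m]≡n (true-≤ᵇ {suc ξ} {m} (∧-trueˡ x≤n)))
         (∣∣-split n x (∧-trueʳ {1 ≤ᵇ suc ξ} 1≤x) (∧-trueʳ {suc ξ ≤ᵇ m} x≤n)) ⟩
  m + ∣ n ∣ᵥ ∎
  where
  X = ∣ x -ᵥ 𝟏 d ∣ᵥ
  Y = ∣ n -ᵥ x ∣ᵥ
  regroup : ∀ a b c e f → (a + b) + (c + e) + suc f ≡ (suc a + c) + (b + e + f)
  regroup = solve-∀

max-pred : ∀ {d} (x : Vec ℕ d) → maxᵥ x ≤ suc (maxᵥ (x -ᵥ 𝟏 d))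
max-pred V.[] = z≤n
max-pred (ξ V.∷ x) = ⊔-lub
  (≤-trans (m≤n+m∸n ξ 1) (s≤s (m≤m⊔n (ξ ∸ 1) _)))
  (≤-trans (max-pred x) (s≤s (m≤n⊔m (ξ ∸ 1) _)))

coeffMul-conv : ∀ f g → coeffMul f g ≗ conv f g
coeffMul-conv f g k = sym (conv-∑ f g k)

module _ {d : ℕ} (n x : Vec ℕ d) (1≤x : leqᵥ (𝟏 d) x ≡ true) (x≤n : leqᵥ x n ≡ true) where

  private
    p = x -ᵥ 𝟏 d
    q = n -ᵥ x
    E₁ = eulerCoeff p
    E₂ = eulerCoeff q
    N = ∣ p ∣ᵥ + ∣ q ∣ᵥ

  -- A nonzero term has j ≤ |p| - max p and k - j ≤ |q| - max q. With |p| + |q| = |n| - d and max x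
  -- ≤ max p + 1 this forces k ≤ ω.
  eulerProduct-degree : ∀ k → ω n x < k → coeffMul E₁ E₂ k ≡ 0
  eulerProduct-degree k ω<k = trans
    (∑-upTo-cong (suc k) {g = λ _ → 0} (λ j j<k → term j (s≤s⁻¹ j<k)))
    (∑-zero (upTo (suc k)))
    where
    term : ∀ j → j ≤ k → E₁ j * E₂ (k ∸ j) ≡ 0
    term j j≤k with j + maxᵥ p ≤? ∣ p ∣ᵥ | (k ∸ j) + maxᵥ q ≤? ∣ q ∣ᵥ
    ... | no ≰ | _ = cong (_* E₂ (k ∸ j)) (eulerCoeff-degree p j (≰⇒> ≰))
    ... | yes _ | no ≰ = trans (cong (E₁ j *_) (eulerCoeff-degree q (k ∸ j) (≰⇒> ≰))) (*-zeroʳ (E₁ j))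
    ... | yes ≤₁ | yes ≤₂ = ⊥-elim (<⇒≱ ω<k (m+n≤o⇒m≤o∸n k bound))
      where
      bound : k + (maxᵥ x + maxᵥ q + d) ≤ ∣ n ∣ᵥ + 1
      bound = ≤-trans
        (+-monoʳ-≤ k (+-monoˡ-≤ d (+-monoˡ-≤ (maxᵥ q) (max-pred x))))
        (subst₂ _≤_
          (trans (regroup j (maxᵥ p) (k ∸ j) (maxᵥ q) d) (cong (_+ (suc (maxᵥ p) + maxᵥ q + d)) (m+[n∸m]≡n j≤k)))
          (cong (_+ 1) (∣∣-split n x 1≤x x≤n))
          (+-monoˡ-≤ 1 (+-monoˡ-≤ d (+-mono-≤ ≤₁ ≤₂))))
        where
        regroup : ∀ a b c e f → ((a + b) + (c + e) + f) + 1 ≡ (a + c) + (suc b + e + f)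
        regroup = solve-∀

  Σ¹-euler : ∀ s → Σ¹ n (suc s) x ≡ ∑ (upTo (suc s)) (λ k → conv E₁ E₂ k * H (suc N) (s ∸ k))
  Σ¹-euler s = begin
    Σ¹ n (suc s) x
      ≡⟨ Σ¹-conv n x s 1≤x x≤n ⟩
    conv (H₊ p) (H₊ q) s
      ≡⟨ conv-cong (macMahon p) (macMahon q) s ⟨
    conv (conv E₁ (H ∣ p ∣ᵥ)) (conv E₂ (H ∣ q ∣ᵥ)) s
      ≡⟨ conv-interchange E₁ (H ∣ p ∣ᵥ) E₂ (H ∣ q ∣ᵥ) s ⟩
    conv (conv E₁ E₂) (conv (H ∣ p ∣ᵥ) (H ∣ q ∣ᵥ)) s
      ≡⟨ conv-cong {conv E₁ E₂} (λ _ → refl) (H-conv ∣ p ∣ᵥ ∣ q ∣ᵥ) s ⟩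
    conv (conv E₁ E₂) (H (suc N)) s
      ≡⟨ conv-∑ (conv E₁ E₂) (H (suc N)) s ⟩
    ∑ (upTo (suc s)) (λ k → conv E₁ E₂ k * H (suc N) (s ∸ k)) ∎

  summand : ℕ → ℕ → ℕ
  summand s k = ((∣ n ∣ᵥ ∸ d + s ∸ k) C (s ∸ k ∸ 1)) * coeffMul E₁ E₂ k

  summand-H : ∀ s k → k ≤ s → conv E₁ E₂ k * H (suc N) (s ∸ k) ≡ summand (suc s) k
  summand-H s k k≤s = begin
    conv E₁ E₂ k * H (suc N) (s ∸ k)
      ≡⟨ *-comm (conv E₁ E₂ k) _ ⟩
    H (suc N) (s ∸ k) * conv E₁ E₂ k
      ≡⟨ cong₂ _*_ (H-C (suc N) (s ∸ k)) (sym (coeffMul-conv E₁ E₂ k)) ⟩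
    ((suc N + (s ∸ k)) C (s ∸ k)) * coeffMul E₁ E₂ k
      ≡⟨ cong₂ (λ u v → (u C v) * coeffMul E₁ E₂ k) upper lower ⟩
    summand (suc s) k ∎
    where
    upper : suc N + (s ∸ k) ≡ ∣ n ∣ᵥ ∸ d + suc s ∸ k
    upper = begin
      suc N + (s ∸ k)                  ≡⟨ +-∸-assoc (suc N) k≤s ⟨
      suc N + s ∸ k                    ≡⟨ cong (_∸ k) (+-suc N s) ⟨
      N + suc s ∸ k                    ≡⟨ cong (λ m → m + suc s ∸ k) (m+n∸n≡m N d) ⟨
      N + d ∸ d + suc s ∸ k            ≡⟨ cong (λ m → m ∸ d + suc s ∸ k) (∣∣-split n x 1≤x x≤n) ⟩
      ∣ n ∣ᵥ ∸ d + suc s ∸ k           ∎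
    lower : s ∸ k ≡ suc s ∸ k ∸ 1
    lower = sym (cong (_∸ 1) (+-∸-assoc 1 k≤s))

  -- Here `s` stands for the s - 1 of the theorem. If it is the smaller bound, the ranges agree;
  -- otherwise the terms beyond ω vanish by degree.
  cutoff : ∀ s → ∑ (upTo (suc s)) (summand (suc s)) ≡ rhs n (suc s) x
  cutoff s with ≤-total s (ω n x)
  ... | inj₁ s≤ω = cong (λ m → ∑ (upTo (suc m)) (summand (suc s))) (sym (m≥n⇒m⊓n≡n s≤ω))
  ... | inj₂ ω≤s = begin
    ∑ (upTo (suc s)) (summand (suc s))
      ≡⟨ cong (λ m → ∑ (upTo (suc m)) (summand (suc s))) (m+[n∸m]≡n ω≤s) ⟨
    ∑ (upTo (suc (ω n x) + (s ∸ ω n x))) (summand (suc s))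
      ≡⟨ ∑-upTo-extend (suc (ω n x)) (s ∸ ω n x) (summand (suc s)) (λ k ω<k →
           trans (cong (((∣ n ∣ᵥ ∸ d + suc s ∸ k) C (suc s ∸ k ∸ 1)) *_) (eulerProduct-degree k ω<k))
                 (*-zeroʳ ((∣ n ∣ᵥ ∸ d + suc s ∸ k) C (suc s ∸ k ∸ 1)))) ⟩
    ∑ (upTo (suc (ω n x))) (summand (suc s))
      ≡⟨ cong (λ m → ∑ (upTo (suc m)) (summand (suc s))) (m≤n⇒m⊓n≡m ω≤s) ⟨
    rhs n (suc s) x ∎

  Σ¹-rhs : ∀ s → Σ¹ n (suc s) x ≡ rhs n (suc s) x
  Σ¹-rhs s = begin
    Σ¹ n (suc s) x
      ≡⟨ Σ¹-euler s ⟩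
    ∑ (upTo (suc s)) (λ k → conv E₁ E₂ k * H (suc N) (s ∸ k))
      ≡⟨ ∑-upTo-cong (suc s) (λ k k<s → summand-H s k (s≤s⁻¹ k<s)) ⟩
    ∑ (upTo (suc s)) (summand (suc s))
      ≡⟨ cutoff s ⟩
    rhs n (suc s) x ∎

theorem6p1 : (d : ℕ) → 1 ≤ d → (n : Vec ℕ d) → (∀ i → 1 ≤ lookup n i) →
    (s : ℕ) → 1 ≤ s → (x : Vec ℕ d) → (∀ i → 1 ≤ lookup x i × lookup x i ≤ lookup n i) →
    Σ¹ n s x ≡ rhs n s x
theorem6p1 d _ n _ (suc s) _ x x∈Π =
  Σ¹-rhs n x (lookup⇒𝟏≤ x (proj₁ ∘ x∈Π)) (lookup⇒leq x n (proj₂ ∘ x∈Π)) s
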